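{- Let $q$ be a power of an odd prime, let $r\ge1$ be an integer and $t=2r+1$. If for some $\mu\in\mathbb{F}_q$ the polynomial $x^{2r+1}-\mu\in\mathbb{F}_q[x]$ is irreducible, then \[ \chi(G_{q^t})\le\frac{2r+5}{3}\,q^{\frac{4r}{3}+1}+(2r+1)q^{r+1}. \]
   Context: For a power $Q$ of an odd prime, the graph $G_Q$ has vertex set $\mathbb{F}_Q\times\mathbb{F}_Q$, and distinct vertices $(x_1,x_2)$, $(y_1,y_2)$ are adjacent if and only if $(x_1+y_1)^2=x_2+y_2$; $G_Q$ has no loops. $\chi$ denotes the chromatic number. -}

module Defs where

open import Level using (Level; _⊔_) renaming (suc to lsuc)
open import Algebra.Bundles using (CommutativeRing; RawSemiring)
import Algebra.Definitions.RawSemiring as RawSemiringDefs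
open import Data.Nat as ℕ using (ℕ; zero; suc; _^_)
import Data.Nat.Properties as ℕₚ
open import Data.Nat.Primality using (Prime)
open import Data.Integer using (+_)
open import Data.Rational as ℚ using (ℚ)
open import Data.Fin using (Fin; finToFun; funToFin; _≟_)
open import Data.Fin.Properties using (any?; all?; *↔×; finToFun-funToFin)
open import Data.List using (List; []; _∷_; map)
open import Data.Product using (_×_; _,_; proj₁; proj₂; ∃; ∃₂)
open import Data.Product.Relation.Binary.Pointwise.NonDependent using (_×ₛ_; Pointwise-≡↔≡)
open import Data.Product.Function.NonDependent.Setoid using (_×-inverse_)
open import Data.Sum using (inj₁; inj₂)
open import Function.Base using (_∘_)
open import Function.Bundles using (Func; Inverse)
open import Function.Properties.Inverse using (Inverse⇒Injection)
import Function.Construct.Composition as Compose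
import Function.Construct.Symmetry as Symmetry
open import Relation.Binary.Bundles using (Setoid)
open import Relation.Binary.Core using (Rel)
open import Relation.Binary.Definitions using (Decidable; Irreflexive; Symmetric; _Respects₂_)
open import Relation.Binary.PropositionalEquality as ≡ using (_≡_; _≢_)
open import Relation.Nullary using (¬_; Dec; yes; no; contradiction)
open import Relation.Nullary.Decidable using (map′; _→-dec_; ¬?; _×-dec_; via-injection)

private
  variable
    c ℓ : Level

IsOddPrimePower : ℕ → Set
IsOddPrimePower q = ∃₂ λ p k → Prime p × p ≢ 2 × 1 ℕ.≤ k × q ≡ p ^ k

record FiniteField c ℓ (n : ℕ) : Set (lsuc (c ⊔ ℓ)) where
  field
    commutativeRing : CommutativeRing c ℓ

  open CommutativeRing commutativeRing public

  field
    0≉1         : ¬ (0# ≈ 1#)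
    inverse     : ∀ x → ¬ (x ≈ 0#) → ∃ λ y → x * y ≈ 1#
    enumeration : Inverse setoid (≡.setoid (Fin n))

-- A polynomial is its list of coefficients, constant term first.
-- Trailing zeros are allowed, so equality is equality of all coefficients.

module Polynomial (R : CommutativeRing c ℓ) where
  open CommutativeRing R

  Poly : Set c
  Poly = List Carrier

  coeff : Poly → ℕ → Carrier
  coeff []      _       = 0#
  coeff (a ∷ p) zero    = a
  coeff (a ∷ p) (suc i) = coeff p i

  infixl 6 _+ᴾ_
  _+ᴾ_ : Poly → Poly → Poly
  []      +ᴾ q       = q
  (a ∷ p) +ᴾ []      = a ∷ p
  (a ∷ p) +ᴾ (b ∷ q) = (a + b) ∷ (p +ᴾ q)

  infixl 7 _*ᴾ_
  _*ᴾ_ : Poly → Poly → Poly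
  []      *ᴾ q = []
  (a ∷ p) *ᴾ q = map (a *_) q +ᴾ (0# ∷ (p *ᴾ q))

  rawSemiring : RawSemiring c ℓ
  rawSemiring = record
    { Carrier = Poly
    ; _≈_     = λ p q → ∀ i → coeff p i ≈ coeff q i
    ; _+_     = _+ᴾ_
    ; _*_     = _*ᴾ_
    ; 0#      = []
    ; 1#      = 1# ∷ []
    }

  open RawSemiringDefs rawSemiring public using (Irreducible) renaming (_^_ to _^ᴾ_)

  X : Poly
  X = 0# ∷ 1# ∷ []

  X^_-_ : ℕ → Carrier → Poly
  X^ n - μ = X ^ᴾ n +ᴾ (- μ ∷ [])

record FiniteGraph v e a : Set (lsuc (v ⊔ e ⊔ a)) where
  field
    vertices    : Setoid v e
    order       : ℕ
    enumeration : Inverse vertices (≡.setoid (Fin order))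

  open Setoid vertices public renaming (Carrier to Vertex) using (_≈_)

  field
    Adjacent       : Rel Vertex a
    Adjacent-resp  : Adjacent Respects₂ _≈_
    Adjacent-sym   : Symmetric Adjacent
    Adjacent-irr   : Irreflexive _≈_ Adjacent
    adjacent?      : Decidable Adjacent

module _ {v e a} (G : FiniteGraph v e a) where
  open FiniteGraph G

  record Colouring (n : ℕ) : Set (v ⊔ e ⊔ a) where
    field
      colour : Func vertices (≡.setoid (Fin n))
      proper : ∀ {u w} → Adjacent u w → Func.to colour u ≢ Func.to colour w

  IsChromaticNumber : ℕ → Set (v ⊔ e ⊔ a)
  IsChromaticNumber n = Colouring n × (∀ m → Colouring m → n ℕ.≤ m)

  private
    module E = Inverse enumeration

    -- Colourings read off on the enumerated vertices.
    Proper : ∀ {n} → (Fin order → Fin n) → Set a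
    Proper f = ∀ i j → Adjacent (E.from i) (E.from j) → f i ≢ f j

    proper? : ∀ {n} (f : Fin order → Fin n) → Dec (Proper f)
    proper? f = all? λ i → all? λ j →
      adjacent? (E.from i) (E.from j) →-dec ¬? (f i ≟ f j)

    fromTo : ∀ u → E.from (E.to u) ≈ u
    fromTo = E.strictlyInverseʳ

    colouring : ∀ {n} (f : Fin order → Fin n) → Proper f → Colouring n
    colouring f pr = record
      { colour = record { to = f ∘ E.to ; cong = ≡.cong f ∘ E.to-cong }
      ; proper = λ {u} {w} u~w → pr (E.to u) (E.to w)
          (proj₁ Adjacent-resp (V.sym (fromTo w))
            (proj₂ Adjacent-resp (V.sym (fromTo u)) u~w))
      }
      where module V = Setoid vertices

    encode : ∀ {n} → Colouring n → ∃ λ (k : Fin (n ^ order)) → Proper (finToFun k)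
    encode {n} C = funToFin g , λ i j i~j eq → proper i~j
      (≡.trans (≡.sym (finToFun-funToFin g i)) (≡.trans eq (finToFun-funToFin g j)))
      where
        open Colouring C
        g : Fin order → Fin n
        g = Func.to colour ∘ E.from

    colourable? : ∀ n → Dec (Colouring n)
    colourable? n = map′ (λ (k , pr) → colouring (finToFun k) pr) encode
      (any? {n ^ order} λ k → proper? (finToFun k))

    discrete : Colouring order
    discrete = colouring (λ i → i) λ i j i~j i≡j → Adjacent-irr (E.from-cong i≡j) i~j

    search : ∀ n → (∀ m → m ℕ.< n → ¬ Colouring m) → ∀ fuel → Colouring (fuel ℕ.+ n) →
             ∃ IsChromaticNumber
    search n none fuel C with colourable? n
    ... | yes D = n , D , λ m M → ℕₚ.≮⇒≥ λ m<n → none m m<n M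
    search n none zero    C | no ¬D = contradiction C ¬D
    search n none (suc k) C | no ¬D =
      search (suc n) none′ k (≡.subst Colouring (≡.sym (ℕₚ.+-suc k n)) C)
      where
        none′ : ∀ m → m ℕ.< suc n → ¬ Colouring m
        none′ m m<1+n with ℕₚ.m≤n⇒m<n∨m≡n (ℕₚ.≤-pred m<1+n)
        ... | inj₁ m<n    = none m m<n
        ... | inj₂ ≡.refl = ¬D

  hasChromaticNumber : ∃ IsChromaticNumber
  hasChromaticNumber =
    search 0 (λ _ ()) order (≡.subst Colouring (≡.sym (ℕₚ.+-identityʳ order)) discrete)

  χ : ℕ
  χ = proj₁ hasChromaticNumber

G : ∀ {Q} → FiniteField c ℓ Q → FiniteGraph c ℓ ℓ
G {Q = Q} K = record
  { vertices      = vertices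
  ; order         = Q ℕ.* Q
  ; enumeration   = Compose.inverse (enumeration ×-inverse enumeration)
                      (Compose.inverse Pointwise-≡↔≡ (Symmetry.inverse *↔×))
  ; Adjacent      = Adj
  ; Adjacent-resp =
        (λ {x} {y} {z} y≈z (x≉y , e) →
          (λ x≈z → x≉y (V.trans {x} {z} {y} x≈z (V.sym {y} {z} y≈z))) ,
          trans (square-cong (+-congˡ (sym (proj₁ y≈z)))) (trans e (+-congˡ (proj₂ y≈z))))
      , (λ {y} {x} {z} x≈z (x≉y , e) →
          (λ z≈y → x≉y (V.trans {x} {z} {y} x≈z z≈y)) ,
          trans (square-cong (+-congʳ (sym (proj₁ x≈z)))) (trans e (+-congʳ (proj₂ x≈z))))
  ; Adjacent-sym  = λ {x} {y} (x≉y , e) →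
        (λ y≈x → x≉y (V.sym {y} {x} y≈x)) ,
        trans (square-cong (+-comm _ _)) (trans e (+-comm _ _))
  ; Adjacent-irr  = λ x≈y (x≉y , _) → x≉y x≈y
  ; adjacent?     = λ (x₁ , x₂) (y₁ , y₂) →
      ¬? ((x₁ ≈? y₁) ×-dec (x₂ ≈? y₂)) ×-dec (((x₁ + y₁) * (x₁ + y₁)) ≈? (x₂ + y₂))
  }
  where
    open FiniteField K
    vertices = setoid ×ₛ setoid
    module V = Setoid vertices

    Adj : Rel (Carrier × Carrier) _
    Adj x@(x₁ , x₂) y@(y₁ , y₂) = ¬ (x V.≈ y) × (x₁ + y₁) * (x₁ + y₁) ≈ x₂ + y₂

    square-cong : ∀ {x y} → x ≈ y → x * x ≈ y * y
    square-cong x≈y = *-cong x≈y x≈y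

    _≈?_ : Decidable _≈_
    _≈?_ = via-injection (Inverse⇒Injection enumeration) _≟_

fromℕ : ℕ → ℚ
fromℕ n = + n ℚ./ 1

-- y ≥ m^(1/3). The real cube root of m is the infimum of the rationals y with
-- this property, so for rational A ≥ 0 a real inequality u ≤ A·m^(1/3) + B
-- says exactly that u ≤ A·y + B for every rational y ≥∛ m.
-- In particular q^(4r/3+1) is the cube root of m = q^(4r+3).
_≥∛_ : ℚ → ℕ → Set
y ≥∛ m = fromℕ m ℚ.≤ y ℚ.* y ℚ.* y

{-# OPTIONS --safe #-}

-- Put Q = q^t = p^n. In the coordinates (x , z) with z = x₂ - 2x₁², adjacency
-- reads z + z′ = -(x - x′)². Choose β of degree at least s = 1 + σ over the prime
-- field, and let W and L be the spans of 1, …, β^σ and of 1, …, β^(2σ) over the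
-- prime field, so that W W ⊆ L. Vertices with z ∉ L are coloured by the coset
-- x + W and a sign telling z + L from -z + L; this takes 2 p^(n-s) colours.
-- Vertices with z ∈ L are coloured greedily: adjacent ones differ by d = x - x′
-- with d² ∈ L, and there are at most p^(n-s) + p^(2s-1) such d. With s close to
-- 2nr / (3t) the total is at most (7/3) q^(4r/3+1) + 1.

module Submission where

open import Defs
open import Algebra.Bundles using (CommutativeRing; RawRing)
import Algebra.Properties.AbelianGroup
import Algebra.Properties.CommutativeMonoid.Sum
import Algebra.Properties.Ring
import Algebra.Properties.Semiring.Mult
import Algebra.Solver.Ring
open import Algebra.Solver.Ring.AlmostCommutativeRing
  using (fromCommutativeRing; _-Raw-AlmostCommutative⟶_)
open import Data.Fin as Fin using (Fin; zero; suc; toℕ; finToFun; funToFin; combine)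
open import Data.Fin.Permutation using (Permutation′)
import Data.Fin.Properties as Finₚ
open import Data.Integer as ℤ using (+_)
import Data.Integer.Properties as ℤₚ
open import Data.Maybe as Maybe using (Maybe)
open import Data.Nat as ℕ using (ℕ; zero; suc; z≤n; s≤s; NonZero)
open import Data.Nat.Coprimality using (prime⇒coprime; coprime-Bézout)
open import Data.Nat.Divisibility using (m%n≡0⇒n∣m)
import Data.Nat.DivMod as DivMod
open import Data.Nat.GCD using (module Bézout)
open import Data.Nat.Primality using (Prime; prime⇒nonZero; prime⇒nonTrivial; prime⇒irreducible)
import Data.Nat.Properties as ℕₚ
import Data.Nat.Solver as ℕSolver
open import Data.Product using (∃; ∃₂; _×_; _,_; proj₁; proj₂)
open import Data.Product.Properties using (,-injective)
import Data.Rational as ℚ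
open ℚ using (ℚ; toℚᵘ)
import Data.Rational.Properties as ℚₚ
open import Data.Rational.Unnormalised as ℚᵘ using (mkℚᵘ; *≡*; *≤*)
import Data.Rational.Unnormalised.Properties as ℚᵘₚ
open import Data.Sum using (_⊎_; inj₁; inj₂)
open import Data.Sum.Properties using (inj₁-injective; inj₂-injective)
open import Data.Unit using (tt)
open import Function.Base using (_∘_)
open import Function.Bundles using (Inverse; mk↔ₛ′)
open import Function.Definitions using (Injective)
open import Function.Properties.Inverse using (Inverse⇒Injection)
open import Level as Level using (0ℓ; _⊔_)
open import Relation.Binary.Core using (Rel)
open import Relation.Binary.Definitions using (Decidable; Irreflexive; Symmetric)
open import Relation.Binary.PropositionalEquality as ≡ using (_≡_; _≢_)
import Relation.Binary.Reasoning.Setoid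
open import Relation.Binary.Structures using (IsEquivalence)
open import Relation.Nullary using (¬_; Dec; yes; no; contradiction)
open import Relation.Nullary.Decidable
  using (¬?; _→-dec_; _×-dec_; decidable-stable; dec⇒maybe; map′; via-injection)

-- Finite combinatorics

-- The obstacle is to make W large while a group containing all its products stays small. Products
-- from a general s-dimensional W can span about s²/2 dimensions; the powers of one β keep them
-- within 2s - 1. The degree condition on β gives W exactly p^s elements, hence p^(n-s) cosets; for
-- L an upper bound on its size is enough. The sign works because p is odd: z + L = -z + L means 2z
-- ∈ L, hence z ∈ L. For z ∈ L it says nothing, so these vertices get a palette of their own. Their
-- degrees are small because, if d₀ and d₀ + b with b ∈ W both have squares in L, then
-- multiplication by b maps the whole coset d₀ + W into L. The palettes have 3 p^(n-s) + p^(2s-1) +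
-- 1 colours together. The factor 7/3 is the value of (2r+5)/3 at r = 1. Since s has to be an
-- integer, each residue modulo 3 of the exponent is checked to stay within this factor, and the
-- final 1 is absorbed by (2r+1) q^(r+1).

greedyColouring : ∀ n k {ℓ} {A : Rel (Fin n) ℓ} → Decidable A → Symmetric A → Irreflexive _≡_ A →
  (∀ i → ¬ ∃ λ (g : Fin k → Fin n) → Injective _≡_ _≡_ g × ∀ c → A i (g c)) →
  ∃ λ (f : Fin n → Fin k) → ∀ {i j} → A i j → f i ≢ f j
greedyColouring zero    k         A? A-sym A-irr deg = (λ ()) , λ {i} → contradiction i λ ()
greedyColouring (suc n) k {A = A} A? A-sym A-irr deg
  with f , proper ← greedyColouring n k (λ i j → A? (suc i) (suc j)) A-sym
         (λ { ≡.refl → A-irr ≡.refl })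
         (λ i (g , g-inj , nbr) → deg (suc i)
           ((λ c → suc (g c)) , (λ e → g-inj (Finₚ.suc-injective e)) , nbr))
  with Finₚ.any? (λ c → Finₚ.all? λ j → A? zero (suc j) →-dec ¬? (f j Finₚ.≟ c))
... | yes (c , free) = f′ , λ {i} {j} → proper′ i j
  where
    f′ : Fin (suc n) → Fin k
    f′ zero    = c
    f′ (suc i) = f i

    proper′ : ∀ i j → A i j → f′ i ≢ f′ j
    proper′ zero    zero    a = contradiction a (A-irr ≡.refl)
    proper′ zero    (suc j) a = λ e → free j a (≡.sym e)
    proper′ (suc i) zero    a = free i (A-sym a)
    proper′ (suc i) (suc j) a = proper a
-- If every colour is blocked, one neighbour of `zero` for each colour gives an injection of the k
-- colours into its neighbours, which `deg` forbids.
... | no used = contradiction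
    ( (λ c → suc (proj₁ (blocked c)))
    , (λ {c} {d} e → ≡.trans (≡.sym (proj₂ (proj₂ (blocked c))))
        (≡.trans (≡.cong f (Finₚ.suc-injective e)) (proj₂ (proj₂ (blocked d)))))
    , λ c → proj₁ (proj₂ (blocked c)) )
    (deg zero)
  where
    blocked : ∀ c → ∃ λ j → A zero (suc j) × f j ≡ c
    blocked c with Finₚ.¬∀⟶∃¬ n _ (λ j → A? zero (suc j) →-dec ¬? (f j Finₚ.≟ c))
                     (λ free → used (c , free))
    ... | j , ¬free = j
      , decidable-stable (A? zero (suc j)) (λ ¬a → ¬free λ a → contradiction a ¬a)
      , decidable-stable (f j Finₚ.≟ c) (λ ne → ¬free λ _ → ne)

-- Classes are numbered so that they can be counted, and so that the order of the numbers can later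
-- serve as a linear order on cosets.
record Quotient {n ℓ} (_∼_ : Rel (Fin n) ℓ) : Set ℓ where
  field
    size        : ℕ
    class       : Fin n → Fin size
    rep         : Fin size → Fin n
    class-cong  : ∀ {i j} → i ∼ j → class i ≡ class j
    class-exact : ∀ {i j} → class i ≡ class j → i ∼ j
    class-rep   : ∀ c → class (rep c) ≡ c

abstract
  -- Induction on n: `zero` joins the class of a related later element if there is one, and opens a
  -- new class otherwise.
  quotient : ∀ {n ℓ} {_∼_ : Rel (Fin n) ℓ} → IsEquivalence _∼_ → Decidable _∼_ → Quotient _∼_
  quotient {zero} _ _ = record
    { size = 0 ; class = λ () ; rep = λ () ; class-cong = λ {i} → contradiction i λ ()
    ; class-exact = λ {i} → contradiction i λ () ; class-rep = λ () }
  quotient {suc n} {_∼_ = _∼_} isEq _∼?_ = extend (Finₚ.any? λ j → zero ∼? suc j)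
    where
      open IsEquivalence isEq
      tail : Quotient (λ i j → suc i ∼ suc j)
      tail = quotient (record { refl = refl ; sym = sym ; trans = trans })
        (λ i j → suc i ∼? suc j)

      open Quotient tail

      extend : Dec (∃ λ j → zero ∼ suc j) → Quotient _∼_
      extend (yes (j , 0∼j)) = record
        { size = size ; class = class′ ; rep = λ c → suc (rep c)
        ; class-cong = λ {i} {k} → cong′ i k ; class-exact = λ {i} {k} → exact′ i k
        ; class-rep = class-rep }
        where
          class′ : Fin (suc n) → Fin size
          class′ zero    = class j
          class′ (suc i) = class i

          cong′ : ∀ i k → i ∼ k → class′ i ≡ class′ k
          cong′ zero    zero    _ = ≡.refl
          cong′ zero    (suc k) e = class-cong (trans (sym 0∼j) e)
          cong′ (suc i) zero    e = class-cong (trans e 0∼j)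
          cong′ (suc i) (suc k) e = class-cong e

          exact′ : ∀ i k → class′ i ≡ class′ k → i ∼ k
          exact′ zero    zero    _ = refl
          exact′ zero    (suc k) e = trans 0∼j (class-exact e)
          exact′ (suc i) zero    e = trans (class-exact e) (sym 0∼j)
          exact′ (suc i) (suc k) e = class-exact e
      extend (no new) = record
        { size = suc size ; class = class′ ; rep = rep′
        ; class-cong = λ {i} {k} → cong′ i k ; class-exact = λ {i} {k} → exact′ i k
        ; class-rep = class-rep′ }
        where
          class′ : Fin (suc n) → Fin (suc size)
          class′ zero    = zero
          class′ (suc i) = suc (class i)

          rep′ : Fin (suc size) → Fin (suc n)
          rep′ zero    = zero
          rep′ (suc c) = suc (rep c)

          class-rep′ : ∀ c → class′ (rep′ c) ≡ c
          class-rep′ zero    = ≡.refl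
          class-rep′ (suc c) = ≡.cong suc (class-rep c)

          cong′ : ∀ i k → i ∼ k → class′ i ≡ class′ k
          cong′ zero    zero    _ = ≡.refl
          cong′ zero    (suc k) e = contradiction (k , e) new
          cong′ (suc i) zero    e = contradiction (i , sym e) new
          cong′ (suc i) (suc k) e = ≡.cong suc (class-cong e)

          exact′ : ∀ i k → class′ i ≡ class′ k → i ∼ k
          exact′ zero    zero    _ = refl
          exact′ (suc i) (suc k) e = class-exact (Finₚ.suc-injective e)

-- A pair (m , n) of coefficients stands for the integer m - n, so that the
-- solver can detect cancellation without deciding equality in R. The operations
-- reduce to pairs with a zero entry, so that normal forms agree definitionally.
module IntegerRingSolver {c ℓ} (R : CommutativeRing c ℓ) where
  open CommutativeRing R
  open import Algebra.Properties.Semiring.Mult semiring using (×-homo-+; ×1-homo-*) renaming (_×_ to _·_)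
  open import Algebra.Properties.Ring ring
  open import Algebra.Properties.AbelianGroup +-abelianGroup using (⁻¹-∙-comm)
  open import Algebra.Properties.CommutativeSemigroup +-commutativeSemigroup using (interchange)
  open import Relation.Binary.Reasoning.Setoid setoid

  private
    ⟦_⟧ᶜ : ℕ × ℕ → Carrier
    ⟦ m , n ⟧ᶜ = m · 1# + - (n · 1#)

    reduce : ℕ × ℕ → ℕ × ℕ
    reduce (m , n) = m ℕ.∸ n , n ℕ.∸ m

    coefficients : RawRing 0ℓ 0ℓ
    coefficients = record
      { Carrier = ℕ × ℕ ; _≈_ = _≡_
      ; _+_ = λ (m , n) (k , l) → reduce (m ℕ.+ k , n ℕ.+ l)
      ; _*_ = λ (m , n) (k , l) → reduce (m ℕ.* k ℕ.+ n ℕ.* l , m ℕ.* l ℕ.+ n ℕ.* k)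
      ; -_  = λ (m , n) → n , m
      ; 0#  = 0 , 0
      ; 1#  = 1 , 0
      }
    module C = RawRing coefficients

    diff-+ : ∀ a b c d → (a + c) + - (b + d) ≈ (a + - b) + (c + - d)
    diff-+ a b c d = trans (+-congˡ (sym (⁻¹-∙-comm b d))) (interchange a c (- b) (- d))

    cancel : ∀ a b c → (a + c) + - (b + c) ≈ a + - b
    cancel a b c = trans (diff-+ a b c c) (trans (+-congˡ (-‿inverseʳ c)) (+-identityʳ _))

    sound : ∀ m n k l → m ℕ.+ l ≡ k ℕ.+ n → ⟦ m , n ⟧ᶜ ≈ ⟦ k , l ⟧ᶜ
    sound m n k l e = begin
      m · 1# + - (n · 1#)
        ≈⟨ sym (cancel _ _ (l · 1#)) ⟩
      (m · 1# + l · 1#) + - (n · 1# + l · 1#)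
        ≈⟨ +-cong (trans (sym (×-homo-+ 1# m l)) (trans (reflexive (≡.cong (_· 1#) e)) (×-homo-+ 1# k n)))
             (-‿cong (+-comm _ _)) ⟩
      (k · 1# + n · 1#) + - (l · 1# + n · 1#)
        ≈⟨ cancel _ _ _ ⟩
      k · 1# + - (l · 1#) ∎

    reduce-sound : ∀ m n → ⟦ reduce (m , n) ⟧ᶜ ≈ ⟦ m , n ⟧ᶜ
    reduce-sound m n = sound (m ℕ.∸ n) (n ℕ.∸ m) m n (balance m n)
      where
        balance : ∀ m n → (m ℕ.∸ n) ℕ.+ n ≡ m ℕ.+ (n ℕ.∸ m)
        balance zero    zero    = ≡.refl
        balance zero    (suc n) = ≡.refl
        balance (suc m) zero    = ≡.refl
        balance (suc m) (suc n) = ≡.trans (ℕₚ.+-suc (m ℕ.∸ n) n) (≡.cong suc (balance m n))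

    +-homo : ∀ x y → ⟦ x C.+ y ⟧ᶜ ≈ ⟦ x ⟧ᶜ + ⟦ y ⟧ᶜ
    +-homo (m , n) (k , l) = trans (reduce-sound (m ℕ.+ k) (n ℕ.+ l)) (trans
      (+-cong (×-homo-+ 1# m k) (-‿cong (×-homo-+ 1# n l)))
      (diff-+ _ _ _ _))

    hom₂ : ∀ m k n l → (m ℕ.* k ℕ.+ n ℕ.* l) · 1# ≈ (m · 1#) * (k · 1#) + (n · 1#) * (l · 1#)
    hom₂ m k n l = trans (×-homo-+ 1# (m ℕ.* k) (n ℕ.* l)) (+-cong (×1-homo-* m k) (×1-homo-* n l))

    *-homo : ∀ x y → ⟦ x C.* y ⟧ᶜ ≈ ⟦ x ⟧ᶜ * ⟦ y ⟧ᶜ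
    *-homo (m , n) (k , l) = begin
      ⟦ reduce (m ℕ.* k ℕ.+ n ℕ.* l , m ℕ.* l ℕ.+ n ℕ.* k) ⟧ᶜ
        ≈⟨ reduce-sound (m ℕ.* k ℕ.+ n ℕ.* l) (m ℕ.* l ℕ.+ n ℕ.* k) ⟩
      (m ℕ.* k ℕ.+ n ℕ.* l) · 1# + - ((m ℕ.* l ℕ.+ n ℕ.* k) · 1#)
        ≈⟨ +-cong (hom₂ m k n l) (-‿cong (trans (hom₂ m l n k) (+-comm _ _))) ⟩
      (M * K + N * L) + - (N * K + M * L)
        ≈⟨ diff-+ _ _ _ _ ⟩
      (M * K + - (N * K)) + (N * L + - (M * L))
        ≈⟨ +-cong (+-congˡ (-‿distribˡ-* N K)) (+-cong (sym -‿*-‿) (-‿distribʳ-* M L)) ⟩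
      (M * K + - N * K) + (- N * - L + M * - L)
        ≈⟨ +-cong (sym (distribʳ K M (- N))) (trans (+-comm _ _) (sym (distribʳ (- L) M (- N)))) ⟩
      (M + - N) * K + (M + - N) * - L
        ≈⟨ sym (distribˡ _ K (- L)) ⟩
      (M + - N) * (K + - L) ∎
      where
        M = m · 1#
        N = n · 1#
        K = k · 1#
        L = l · 1#
        -‿*-‿ : - N * - L ≈ N * L
        -‿*-‿ = trans (sym (-‿distribˡ-* N (- L)))
          (trans (-‿cong (sym (-‿distribʳ-* N L))) (-‿involutive (N * L)))

    morphism : coefficients -Raw-AlmostCommutative⟶ fromCommutativeRing R
    morphism = record
      { ⟦_⟧    = ⟦_⟧ᶜ
      ; +-homo = +-homo
      ; *-homo = *-homo
      ; -‿homo = λ (m , n) → sym (trans (sym (⁻¹-∙-comm _ _))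
          (trans (+-congˡ (-‿involutive (n · 1#))) (+-comm _ _)))
      ; 0-homo = -‿inverseʳ 0#
      ; 1-homo = trans (+-congˡ -0#≈0#) (trans (+-identityʳ _) (+-identityʳ 1#))
      }

    weak≟ : ∀ x y → Maybe (⟦ x ⟧ᶜ ≈ ⟦ y ⟧ᶜ)
    weak≟ (m , n) (k , l) = Maybe.map (sound m n k l) (dec⇒maybe (m ℕ.+ l ℕₚ.≟ k ℕ.+ n))

  open Algebra.Solver.Ring coefficients (fromCommutativeRing R) morphism weak≟ public
    using (solve; _:=_; _:+_; _:*_; :-_; _:-_; con)

funToFin-cong : ∀ {m n} {f g : Fin m → Fin n} → (∀ i → f i ≡ g i) → funToFin f ≡ funToFin g
funToFin-cong {zero}  e = ≡.refl
funToFin-cong {suc m} e = ≡.cong₂ combine (e zero) (funToFin-cong (e ∘ suc))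

finToFun-injective : ∀ {m n} {k l : Fin (n ℕ.^ m)} →
  (∀ i → finToFun {n} {m} k i ≡ finToFun l i) → k ≡ l
finToFun-injective {m} {n} {k} {l} e = ≡.trans (≡.sym (Finₚ.funToFin-finToFin {m} {n} k))
  (≡.trans (funToFin-cong e) (Finₚ.funToFin-finToFin {m} {n} l))

-- Polynomials and prime-field spans in a finite field

module FiniteFieldProperties {c ℓ Q} (K : FiniteField c ℓ Q) where
  open FiniteField K hiding (zero)
  open IntegerRingSolver commutativeRing
  open Algebra.Properties.Semiring.Mult semiring
    using (×-homo-+; ×1-homo-*; ×-congʳ; ×-assoc-*) renaming (_×_ to _·_)
  open Algebra.Properties.CommutativeMonoid.Sum +-commutativeMonoid
    using (sum; ∑-distrib-+; sum-replicate; sum-permute; sum-cong-≋)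
  open Algebra.Properties.AbelianGroup +-abelianGroup using (x∙y⁻¹≈ε⇒x≈y; x≈y⇒x∙y⁻¹≈ε)
  open Relation.Binary.Reasoning.Setoid setoid

  module E = Inverse enumeration

  _≈?_ : Decidable _≈_
  _≈?_ = via-injection (Inverse⇒Injection enumeration) Finₚ._≟_

  from-to : ∀ x → E.from (E.to x) ≈ x
  from-to = E.strictlyInverseʳ

  from-injective : ∀ {i j} → E.from i ≈ E.from j → i ≡ j
  from-injective {i} {j} e = ≡.trans (≡.sym (E.strictlyInverseˡ i))
    (≡.trans (E.to-cong e) (E.strictlyInverseˡ j))

  to-injective : ∀ {x y} → E.to x ≡ E.to y → x ≈ y
  to-injective {x} {y} e = trans (sym (from-to x)) (trans (E.from-cong e) (from-to y))

  minus-zero : ∀ {x y} → x - y ≈ 0# → x ≈ y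
  minus-zero = x∙y⁻¹≈ε⇒x≈y _ _

  zero-minus : ∀ {x y} → x ≈ y → x - y ≈ 0#
  zero-minus = x≈y⇒x∙y⁻¹≈ε

  noZeroDivisors : ∀ {x y} → ¬ (x ≈ 0#) → x * y ≈ 0# → y ≈ 0#
  noZeroDivisors {x} {y} x≉0 xy≈0 with x⁻¹ , e ← inverse x x≉0 = begin
    y              ≈⟨ sym (*-identityˡ y) ⟩
    1# * y         ≈⟨ *-congʳ (trans (sym e) (*-comm x x⁻¹)) ⟩
    (x⁻¹ * x) * y  ≈⟨ *-assoc x⁻¹ x y ⟩
    x⁻¹ * (x * y)  ≈⟨ trans (*-congˡ xy≈0) (zeroʳ x⁻¹) ⟩
    0#             ∎

  cancelˡ : ∀ {x y z} → ¬ (x ≈ 0#) → x * y ≈ x * z → y ≈ z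
  cancelˡ {x} {y} {z} x≉0 e = minus-zero (noZeroDivisors x≉0
    (trans (solve 3 (λ x y z → x :* (y :- z) := x :* y :- x :* z) refl x y z) (zero-minus e)))

  -- Translation by 1 permutes the field, so it does not change the sum of all elements.
  order·1≈0 : Q · 1# ≈ 0#
  order·1≈0 = begin
    Q · 1#                      ≈⟨ solve 2 (λ s x → x := (s :+ x) :- s) refl total (Q · 1#) ⟩
    (total + Q · 1#) - total    ≈⟨ +-congʳ (+-congˡ (sym (sum-replicate Q))) ⟩
    (total + sum {Q} (λ _ → 1#)) - total
                                ≈⟨ +-congʳ (sym (∑-distrib-+ {Q} E.from (λ _ → 1#))) ⟩
    sum (λ i → E.from i + 1#) - total
                                ≈⟨ +-congʳ (sum-cong-≋ {Q} (λ i → sym (from-to (E.from i + 1#)))) ⟩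
    sum (λ i → E.from (shift i)) - total
                                ≈⟨ zero-minus (sym (sum-permute E.from translation)) ⟩
    0#                          ∎
    where
      total : Carrier
      total = sum E.from

      shift unshift : Fin Q → Fin Q
      shift   i = E.to (E.from i + 1#)
      unshift i = E.to (E.from i - 1#)

      translation : Permutation′ Q
      translation = mk↔ₛ′ shift unshift
        (λ i → ≡.trans (E.to-cong (trans (+-congʳ (from-to _))
          (solve 2 (λ x y → (x :- y) :+ y := x) refl (E.from i) 1#))) (E.strictlyInverseˡ i))
        (λ i → ≡.trans (E.to-cong (trans (+-congʳ (from-to _))
          (solve 2 (λ x y → (x :+ y) :- y := x) refl (E.from i) 1#))) (E.strictlyInverseˡ i))

  -- A field has no zero divisors, so p^n · 1 = (p · 1)^n = 0 forces p · 1 = 0.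
  characteristic : ∀ p n → Q ≡ p ℕ.^ n → p · 1# ≈ 0#
  characteristic p n Q≡pⁿ = root n (≡.subst (λ k → k · 1# ≈ 0#) Q≡pⁿ order·1≈0)
    where
      root : ∀ n → (p ℕ.^ n) · 1# ≈ 0# → p · 1# ≈ 0#
      root zero    e = contradiction (sym (trans (sym (+-identityʳ 1#)) e)) 0≉1
      root (suc n) e with (p · 1#) ≈? 0#
      ... | yes p≈0 = p≈0
      ... | no  p≉0 = root n (noZeroDivisors p≉0 (trans (sym (×1-homo-* p (p ℕ.^ n))) e))

  -- Polynomials as coefficient vectors and the number of their roots.

  eval : ∀ {n} → (Fin n → Carrier) → Carrier → Carrier
  eval {zero}  f x = 0#
  eval {suc n} f x = f zero + x * eval (f ∘ suc) x

  eval-cong : ∀ {n} {f g : Fin n → Carrier} x → (∀ i → f i ≈ g i) → eval f x ≈ eval g x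
  eval-cong {zero}  x e = refl
  eval-cong {suc n} x e = +-cong (e zero) (*-congˡ (eval-cong x (e ∘ suc)))

  eval-zero : ∀ {n} {f : Fin n → Carrier} x → (∀ i → f i ≈ 0#) → eval f x ≈ 0#
  eval-zero {zero}  x e = refl
  eval-zero {suc n} x e = trans (+-cong (e zero) (trans (*-congˡ (eval-zero x (e ∘ suc))) (zeroʳ x)))
    (+-identityʳ 0#)

  eval-minus : ∀ {n} (f g : Fin n → Carrier) x → eval (λ i → f i - g i) x ≈ eval f x - eval g x
  eval-minus {zero}  f g x = sym (-‿inverseʳ 0#)
  eval-minus {suc n} f g x = trans (+-congˡ (*-congˡ (eval-minus (f ∘ suc) (g ∘ suc) x)))
    (solve 5 (λ a b x u v → (a :- b) :+ x :* (u :- v) := (a :+ x :* u) :- (b :+ x :* v)) refl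
      (f zero) (g zero) x (eval (f ∘ suc) x) (eval (g ∘ suc) x))

  -- Ruffini's division: the coefficients of (f(X) - f(r)) / (X - r) are the Horner tails of f at r.
  syntheticQuotient : ∀ {n} → (Fin (suc n) → Carrier) → Carrier → Fin n → Carrier
  syntheticQuotient f r zero    = eval (f ∘ suc) r
  syntheticQuotient f r (suc i) = syntheticQuotient (f ∘ suc) r i

  eval-syntheticQuotient : ∀ {n} (f : Fin (suc n) → Carrier) r x →
    eval f x - eval f r ≈ (x - r) * eval (syntheticQuotient f r) x
  eval-syntheticQuotient {zero} f r x =
    solve 4 (λ a x r z → (a :+ x :* z) :- (a :+ r :* z) := (x :- r) :* z) refl (f zero) x r 0#
  eval-syntheticQuotient {suc n} f r x = begin
    (f zero + x * gx) - (f zero + r * gr)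
      ≈⟨ solve 5 (λ a x r u v → (a :+ x :* u) :- (a :+ r :* v) := (x :- r) :* v :+ x :* (u :- v))
           refl (f zero) x r gx gr ⟩
    (x - r) * gr + x * (gx - gr)
      ≈⟨ +-congˡ (*-congˡ (eval-syntheticQuotient (f ∘ suc) r x)) ⟩
    (x - r) * gr + x * ((x - r) * q)
      ≈⟨ solve 4 (λ x d v q → d :* v :+ x :* (d :* q) := d :* (v :+ x :* q)) refl x (x - r) gr q ⟩
    (x - r) * (gr + x * q) ∎
    where
      gx = eval (f ∘ suc) x
      gr = eval (f ∘ suc) r
      q  = eval (syntheticQuotient (f ∘ suc) r) x

  syntheticQuotient-zero : ∀ {n} (f : Fin (suc n) → Carrier) r →
    (∀ i → syntheticQuotient f r i ≈ 0#) → ∀ i → f (suc i) ≈ 0#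
  syntheticQuotient-zero {suc n} f r q≈0 = λ
    { zero    → trans (sym (trans (+-congˡ (trans (*-congˡ (eval-zero r tail≈0)) (zeroʳ r)))
                  (+-identityʳ _))) (q≈0 zero)
    ; (suc i) → tail≈0 i }
    where
      tail≈0 : ∀ i → f (suc (suc i)) ≈ 0#
      tail≈0 = syntheticQuotient-zero (f ∘ suc) r (q≈0 ∘ suc)

  -- Induction on n: dividing by X - r₀ leaves a quotient with one coefficient and one root fewer.
  -- That quotient is zero, so f is constant, and its value at r₀ is zero.
  tooManyRoots : ∀ {n} (f r : Fin n → Carrier) → Injective _≡_ _≈_ r →
    (∀ i → eval f (r i) ≈ 0#) → ∀ i → f i ≈ 0#
  tooManyRoots {suc n} f r r-inj roots = λ
    { zero    → trans (sym (trans (+-congˡ (trans (*-congˡ (eval-zero (r zero) tail≈0)) (zeroʳ _)))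
                  (+-identityʳ _))) (roots zero)
    ; (suc i) → tail≈0 i }
    where
      tail≈0 : ∀ i → f (suc i) ≈ 0#
      tail≈0 = syntheticQuotient-zero f (r zero) (tooManyRoots _ (r ∘ suc)
        (Finₚ.suc-injective ∘ r-inj)
        (λ i → noZeroDivisors (λ e → contradiction (r-inj (minus-zero e)) λ ())
          (trans (sym (eval-syntheticQuotient f (r zero) (r (suc i))))
            (zero-minus (trans (roots (suc i)) (sym (roots zero)))))))

  -- The prime field inside K and spans of powers of an element.

  module Characteristic (p : ℕ) (p-prime : Prime p) (p≈0 : p · 1# ≈ 0#) where
    private instance
      p≢0 : NonZero p
      p≢0 = prime⇒nonZero p-prime

    multiple≈0 : ∀ k {n} → n · 1# ≈ 0# → (k ℕ.* n) · 1# ≈ 0#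
    multiple≈0 k {n} n≈0 = trans (×1-homo-* k n) (trans (*-congˡ n≈0) (zeroʳ _))

    not-consecutive : ∀ {m n} → m · 1# ≈ 0# → n · 1# ≈ 0# → suc m ≢ n
    not-consecutive m≈0 n≈0 e = 0≉1 (sym (trans (sym (+-identityʳ 1#))
      (trans (+-congˡ (sym m≈0)) (trans (reflexive (≡.cong (_· 1#) e)) n≈0))))

    ·1-% : ∀ n → n · 1# ≈ (n ℕ.% p) · 1#
    ·1-% n = begin
      n · 1#
        ≡⟨ ≡.cong (_· 1#) (DivMod.m≡m%n+[m/n]*n n p) ⟩
      (n ℕ.% p ℕ.+ (n ℕ./ p) ℕ.* p) · 1#
        ≈⟨ ×-homo-+ 1# (n ℕ.% p) _ ⟩
      (n ℕ.% p) · 1# + ((n ℕ./ p) ℕ.* p) · 1#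
        ≈⟨ trans (+-congˡ (multiple≈0 (n ℕ./ p) p≈0)) (+-identityʳ _) ⟩
      (n ℕ.% p) · 1# ∎

    ·1-mod : ∀ n → n · 1# ≈ toℕ (n DivMod.mod p) · 1#
    ·1-mod n = trans (·1-% n)
      (reflexive (≡.cong (_· 1#) (≡.sym (Finₚ.toℕ-fromℕ< (DivMod.m%n<n n p)))))

    -- For 0 < n < p, Bézout gives a multiple of n and a multiple of p that differ by 1. Both would
    -- vanish in K, so 1 would too.
    ·1≈0⇒≡0 : ∀ n → n ℕ.< p → n · 1# ≈ 0# → n ≡ 0
    ·1≈0⇒≡0 zero      _   _   = ≡.refl
    ·1≈0⇒≡0 n@(suc _) n<p n≈0 with coprime-Bézout (prime⇒coprime p-prime n<p)
    ... | Bézout.+- x y eq = contradiction eq (not-consecutive (multiple≈0 y n≈0) (multiple≈0 x p≈0))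
    ... | Bézout.-+ x y eq = contradiction eq (not-consecutive (multiple≈0 x p≈0) (multiple≈0 y n≈0))

    scalar : Fin p → Carrier
    scalar a = toℕ a · 1#

    scalar-injective : Injective _≡_ _≈_ scalar
    scalar-injective {a} {b} e = Finₚ.toℕ-injective
      (case (ℕₚ.≤-total (toℕ a) (toℕ b)))
      where
        ordered : ∀ m n → n ℕ.< p → m ℕ.≤ n → m · 1# ≈ n · 1# → m ≡ n
        ordered m n n<p m≤n e = ℕₚ.≤-antisym m≤n (ℕₚ.m∸n≡0⇒m≤n (·1≈0⇒≡0 (n ℕ.∸ m)
          (ℕₚ.≤-<-trans (ℕₚ.m∸n≤m n m) n<p)
          (begin
            (n ℕ.∸ m) · 1#
              ≈⟨ solve 2 (λ x y → y := (x :+ y) :- x) refl (m · 1#) ((n ℕ.∸ m) · 1#) ⟩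
            (m · 1# + (n ℕ.∸ m) · 1#) - m · 1#
              ≈⟨ +-congʳ (sym (×-homo-+ 1# m (n ℕ.∸ m))) ⟩
            (m ℕ.+ (n ℕ.∸ m)) · 1# - m · 1#
              ≡⟨ ≡.cong (λ k → k · 1# - m · 1#) (ℕₚ.m+[n∸m]≡n m≤n) ⟩
            n · 1# - m · 1#
              ≈⟨ zero-minus (sym e) ⟩
            0# ∎)))
        case : toℕ a ℕ.≤ toℕ b ⊎ toℕ b ℕ.≤ toℕ a → toℕ a ≡ toℕ b
        case (inj₁ a≤b) = ordered _ _ (Finₚ.toℕ<n b) a≤b e
        case (inj₂ b≤a) = ≡.sym (ordered _ _ (Finₚ.toℕ<n a) b≤a (sym e))

    _⊖_ : Fin p → Fin p → Fin p
    a ⊖ b = (toℕ a ℕ.+ (p ℕ.∸ toℕ b)) DivMod.mod p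

    scalar-⊖ : ∀ a b → scalar (a ⊖ b) ≈ scalar a - scalar b
    scalar-⊖ a b = begin
      scalar (a ⊖ b)
        ≈⟨ sym (·1-mod (toℕ a ℕ.+ (p ℕ.∸ toℕ b))) ⟩
      (toℕ a ℕ.+ (p ℕ.∸ toℕ b)) · 1#
        ≈⟨ ×-homo-+ 1# (toℕ a) _ ⟩
      scalar a + (p ℕ.∸ toℕ b) · 1#
        ≈⟨ solve 3 (λ a b c → a :+ c := (a :- b) :+ (b :+ c)) refl (scalar a) (scalar b) _ ⟩
      (scalar a - scalar b) + (scalar b + (p ℕ.∸ toℕ b) · 1#)
        ≈⟨ +-congˡ (trans (sym (×-homo-+ 1# (toℕ b) _)) (trans
             (reflexive (≡.cong (_· 1#) (ℕₚ.m+[n∸m]≡n (ℕₚ.<⇒≤ (Finₚ.toℕ<n b))))) p≈0)) ⟩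
      (scalar a - scalar b) + 0#
        ≈⟨ +-identityʳ _ ⟩
      scalar a - scalar b ∎

    -- Coefficients are arbitrary naturals: sums then need no reduction, negation is multiplication
    -- by p - 1, and reduction below p is left to `digits`.
    data Span (β : Carrier) : ℕ → Carrier → Set (c ⊔ ℓ) where
      nil  : ∀ {x} → x ≈ 0# → Span β 0 x
      cons : ∀ {s x y} a → Span β s y → x ≈ a · 1# + β * y → Span β (suc s) x

    module _ {β : Carrier} where
      span-resp : ∀ {s x y} → x ≈ y → Span β s x → Span β s y
      span-resp x≈y (nil e)      = nil (trans (sym x≈y) e)
      span-resp x≈y (cons a S e) = cons a S (trans (sym x≈y) e)

      span-0 : ∀ s → Span β s 0#
      span-0 zero    = nil refl
      span-0 (suc s) = cons 0 (span-0 s) (sym (trans (+-identityˡ _) (zeroʳ β)))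

      span-+ : ∀ {s x y} → Span β s x → Span β s y → Span β s (x + y)
      span-+ (nil e) (nil f) = nil (trans (+-cong e f) (+-identityʳ 0#))
      span-+ (cons {y = x} a S e) (cons {y = y} b T f) = cons (a ℕ.+ b) (span-+ S T)
        (trans (+-cong e f) (trans
          (solve 5 (λ a b β x y → (a :+ β :* x) :+ (b :+ β :* y) := (a :+ b) :+ β :* (x :+ y)) refl
            (a · 1#) (b · 1#) β x y)
          (+-congʳ (sym (×-homo-+ 1# a b)))))

      span-· : ∀ n {s x} → Span β s x → Span β s (n · x)
      span-· zero    S = span-0 _
      span-· (suc n) S = span-+ S (span-· n S)

      span-neg : ∀ {s x} → Span β s x → Span β s (- x)
      span-neg {s} {x} S = span-resp
        (begin
          (p ℕ.∸ 1) · x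
            ≈⟨ solve 2 (λ x y → y := (x :+ y) :+ (:- x)) refl x _ ⟩
          (suc (p ℕ.∸ 1) · x) - x
            ≡⟨ ≡.cong (λ k → k · x - x) (ℕₚ.suc-pred p) ⟩
          p · x - x
            ≈⟨ +-congʳ (trans (×-congʳ p (sym (*-identityˡ x))) (trans (sym (×-assoc-* p 1# x))
                 (trans (*-congʳ p≈0) (zeroˡ x)))) ⟩
          0# - x
            ≈⟨ +-identityˡ _ ⟩
          - x ∎)
        (span-· (p ℕ.∸ 1) S)

      span-suc : ∀ {s x} → Span β s x → Span β (suc s) x
      span-suc (nil e) = span-resp (sym e) (span-0 1)
      span-suc (cons a S e) = cons a (span-suc S) e

      span-weaken : ∀ k {s x} → Span β s x → Span β (k ℕ.+ s) x
      span-weaken zero    S = S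
      span-weaken (suc k) S = span-suc (span-weaken k S)

      -- Degrees add: below s and at most t give below s + t. With t = σ this is the inclusion W W ⊆
      -- L, with 2s - 1 coefficients for L.
      span-* : ∀ {s t x y} → Span β s x → Span β (suc t) y → Span β (s ℕ.+ t) (x * y)
      span-* {t = t} {y = y} (nil e) T = span-resp (sym (trans (*-congʳ e) (zeroˡ y))) (span-0 t)
      span-* {s = suc s} {t} {x} {y} (cons {y = x′} a S e) T = span-resp
        (begin
          a · y + β * (x′ * y)
            ≈⟨ +-congʳ (trans (×-congʳ a (sym (*-identityˡ y))) (sym (×-assoc-* a 1# y))) ⟩
          (a · 1#) * y + β * (x′ * y)
            ≈⟨ solve 4 (λ a y β x → a :* y :+ β :* (x :* y) := (a :+ β :* x) :* y) refl (a · 1#) y β x′ ⟩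
          (a · 1# + β * x′) * y
            ≈⟨ *-congʳ (sym e) ⟩
          x * y ∎)
        (span-+
          (≡.subst (λ k → Span β k (a · y)) (ℕₚ.+-suc s t) (span-· a (span-weaken s T)))
          (cons 0 (span-* S T) (sym (+-identityˡ _))))

    digit : ∀ s → Fin (p ℕ.^ s) → Fin s → Fin p
    digit s = finToFun {p} {s}

    combination : ∀ s → Carrier → Fin (p ℕ.^ s) → Carrier
    combination s β v = eval (scalar ∘ digit s v) β

    combination-funToFin : ∀ {s} β (d : Fin s → Fin p) →
      combination s β (funToFin d) ≈ eval (scalar ∘ d) β
    combination-funToFin {s} β d =
      eval-cong β (λ i → reflexive (≡.cong scalar (Finₚ.finToFun-funToFin d i)))

    span-eval : ∀ {s} β (d : Fin s → Fin p) → Span β s (eval (scalar ∘ d) β)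
    span-eval {zero}  β d = nil refl
    span-eval {suc s} β d = cons (toℕ (d zero)) (span-eval β (d ∘ suc)) refl

    digits : ∀ {β s x} → Span β s x → ∃ λ (d : Fin s → Fin p) → x ≈ eval (scalar ∘ d) β
    digits (nil e) = (λ ()) , e
    digits {β} {suc s} (cons a S e) with d , f ← digits S =
      d′ , trans e (+-cong (·1-mod a) (*-congˡ f))
      where
        d′ : Fin (suc s) → Fin p
        d′ zero    = a DivMod.mod p
        d′ (suc i) = d i

    span-index : ∀ {β s x} → Span β s x → ∃ λ (v : Fin (p ℕ.^ s)) → x ≈ combination s β v
    span-index {β} {s} S with d , e ← digits S =
      funToFin d , trans e (sym (combination-funToFin β d))

    span? : ∀ β s x → Dec (Span β s x)
    span? β s x = map′ (λ (v , e) → span-resp (sym e) (span-eval β (digit s v))) span-index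
      (Finₚ.any? λ v → x ≈? combination s β v)

    -- The relation is stored as a number below p^s. Dependence is then decidable by search, and
    -- relations can be counted in a pigeonhole argument.
    Dependent : ℕ → Carrier → Set ℓ
    Dependent s β = ∃ λ (v : Fin (p ℕ.^ s)) →
      (∃ λ i → ¬ (scalar (digit s v i) ≈ 0#)) × combination s β v ≈ 0#

    dependent? : ∀ s β → Dec (Dependent s β)
    dependent? s β = Finₚ.any? λ v →
      Finₚ.any? (λ i → ¬? (scalar (digit s v i) ≈? 0#)) ×-dec (combination s β v ≈? 0#)

    -- By `_⊖_`, two digit vectors with equal values have a difference that is again a digit vector,
    -- with value zero. Independence leaves it no nonzero digit.
    combination-injective : ∀ {s β} → ¬ Dependent s β → Injective _≡_ _≈_ (combination s β)
    combination-injective {s} {β} indep {v} {w} e = finToFun-injective {s} {p} λ i →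
      scalar-injective (minus-zero (trans (sym (scalar-⊖ (digit s v i) (digit s w i)))
        (trans (reflexive (≡.cong scalar (≡.sym (Finₚ.finToFun-funToFin d i)))) (zero-digits i))))
      where
        d : Fin s → Fin p
        d i = digit s v i ⊖ digit s w i

        vanishes : combination s β (funToFin d) ≈ 0#
        vanishes = trans (combination-funToFin β d)
          (trans (eval-cong β (λ i → scalar-⊖ (digit s v i) (digit s w i)))
            (trans (eval-minus (scalar ∘ digit s v) (scalar ∘ digit s w) β) (zero-minus e)))

        zero-digits : ∀ i → scalar (digit s (funToFin d) i) ≈ 0#
        zero-digits i = decidable-stable (scalar (digit s (funToFin d) i) ≈? 0#)
          λ ne → indep (funToFin d , (i , ne) , vanishes)

    -- Elements sharing a dependence relation are roots of one polynomial of
    -- degree < s, so they can be told apart by s colours.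
    independentElement : ∀ s → p ℕ.^ s ℕ.* s ℕ.< Q → ∃ λ β → ¬ Dependent s β
    independentElement s small with Finₚ.all? (λ i → dependent? s (E.from i))
    ... | no ¬all with i , indep ← Finₚ.¬∀⟶∃¬ Q _ (λ i → dependent? s (E.from i)) ¬all =
      E.from i , indep
    ... | yes dep = contradiction (Finₚ.injective⇒≤ separated) (ℕₚ.<⇒≱ small)
      where
        relation : Fin Q → Fin (p ℕ.^ s)
        relation i = proj₁ (dep i)

        Shared : Rel (Fin Q) 0ℓ
        Shared i j = i ≢ j × relation i ≡ relation j

        few : ∀ i → ¬ ∃ λ (g : Fin s → Fin Q) → Injective _≡_ _≡_ g × ∀ c → Shared i (g c)
        few i (g , g-inj , shared) = proj₂ (proj₁ (proj₂ (dep i)))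
          (tooManyRoots (scalar ∘ digit s (relation i)) (E.from ∘ g) (g-inj ∘ from-injective)
            (λ c → ≡.subst (λ v → combination s (E.from (g c)) v ≈ 0#)
              (≡.sym (proj₂ (shared c))) (proj₂ (proj₂ (dep (g c)))))
            (proj₁ (proj₁ (proj₂ (dep i)))))

        colouring = greedyColouring Q s
          (λ i j → ¬? (i Finₚ.≟ j) ×-dec (relation i Finₚ.≟ relation j))
          (λ (ne , e) → (ne ∘ ≡.sym) , ≡.sym e) (λ e (ne , _) → ne e) few

        separated : Injective _≡_ _≡_ (λ i → combine (relation i) (proj₁ colouring i))
        separated {i} {j} e with r≡ , c≡ ← Finₚ.combine-injective (relation i) _ (relation j) _ e =
          decidable-stable (i Finₚ.≟ j) λ ne → proj₂ colouring (ne , r≡) c≡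

-- Colouring from a pair of subgroups W, L with W W ⊆ L

record DecSubgroup {c ℓ} (R : CommutativeRing c ℓ) h : Set (c ⊔ ℓ ⊔ Level.suc h) where
  open CommutativeRing R
  field
    H     : Carrier → Set h
    H?    : ∀ x → Dec (H x)
    resp  : ∀ {x y} → x ≈ y → H x → H y
    H-0   : H 0#
    H-+   : ∀ {x y} → H x → H y → H (x + y)
    H-neg : ∀ {x} → H x → H (- x)

  open IntegerRingSolver R
  open Algebra.Properties.Semiring.Mult semiring using (×-homo-+; ×-assoc-*; ×-congʳ) renaming (_×_ to _·_)

  H-· : ∀ n {x} → H x → H (n · x)
  H-· ℕ.zero  _  = H-0
  H-· (suc n) hx = H-+ hx (H-· n hx)

  -- In characteristic dividing 2h + 1, half of y is -h y, which every subgroup containing y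
  -- contains as well.
  module Halving (h : ℕ) (odd≈0 : suc (h ℕ.+ h) · 1# ≈ 0#) where
    halve : ∀ {x} → H (x + x) → H x
    halve {x} hx = resp eq (H-neg (H-· h hx))
      where
        open Relation.Binary.Reasoning.Setoid setoid
        n = h · 1#
        expand : ∀ k y → k · y ≈ (k · 1#) * y
        expand k y = trans (×-congʳ k (sym (*-identityˡ y))) (sym (×-assoc-* k 1# y))
        eq : - (h · (x + x)) ≈ x
        eq = begin
          - (h · (x + x))               ≈⟨ -‿cong (expand h (x + x)) ⟩
          - (n * (x + x))
            ≈⟨ solve 3 (λ n x u → :- (n :* (x :+ x)) := (u :* x) :- (u :+ (n :+ n)) :* x) refl n x 1# ⟩
          1# * x - (1# + (n + n)) * x
            ≈⟨ +-cong (*-identityˡ x)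
                 (-‿cong (trans (*-congʳ (trans (+-congˡ (sym (×-homo-+ 1# h h))) odd≈0)) (zeroˡ x))) ⟩
          x - 0#                        ≈⟨ +-congˡ (Algebra.Properties.Ring.-0#≈0# ring) ⟩
          x + 0#                        ≈⟨ +-identityʳ x ⟩
          x                             ∎

  cosets : ∀ {n} (pt : Fin n → Carrier) → Quotient (λ i j → H (pt i - pt j))
  cosets pt = quotient
    (record
      { refl  = λ {i} → resp (sym (-‿inverseʳ (pt i))) H-0
      ; sym   = λ {i} {j} e → resp (solve 2 (λ x y → :- (x :- y) := y :- x) refl (pt i) (pt j)) (H-neg e)
      ; trans = λ {i} {j} {k} e f →
          resp (solve 3 (λ x y z → (x :- y) :+ (y :- z) := x :- z) refl (pt i) (pt j) (pt k)) (H-+ e f) })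
    (λ i j → H? (pt i - pt j))

order : ∀ {p} {P : Set p} → Dec P → Fin 2
order (yes _) = zero
order (no _)  = suc zero

-- At most one of i < j and j < i holds, so equal answers mean that both fail. This is what turns a
-- comparison into a sign.
order-antisym : ∀ {n} (i j : Fin n) → order (i Finₚ.<? j) ≡ order (j Finₚ.<? i) → i ≡ j
order-antisym i j e with i Finₚ.<? j | j Finₚ.<? i
... | yes i<j | yes j<i = contradiction j<i (Finₚ.<-asym i<j)
... | no  i≮j | no  j≮i = Finₚ.≤-antisym (ℕₚ.≮⇒≥ j≮i) (ℕₚ.≮⇒≥ i≮j)

remQuot-injective : ∀ {m} n {i j : Fin (m ℕ.* n)} → Fin.remQuot {m} n i ≡ Fin.remQuot n j → i ≡ j
remQuot-injective {m} n {i} {j} eq = ≡.trans (≡.sym (Finₚ.combine-remQuot {m} n i))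
  (≡.trans (≡.cong (λ (a , b) → combine a b) eq) (Finₚ.combine-remQuot {m} n j))

injective⇒*≤ : ∀ {m n k} {f : Fin m × Fin n → Fin k} → Injective _≡_ _≡_ f → m ℕ.* n ℕ.≤ k
injective⇒*≤ {n = n} f-inj = Finₚ.injective⇒≤ (remQuot-injective n ∘ f-inj)

pack : ∀ {m n k} → (Fin m × Fin n) ⊎ Fin k → Fin (m ℕ.* n ℕ.+ k)
pack {m} {n} {k} (inj₁ (i , j)) = Fin.join (m ℕ.* n) k (inj₁ (combine i j))
pack {m} {n} {k} (inj₂ i)       = Fin.join (m ℕ.* n) k (inj₂ i)

pack-injective : ∀ {m n k} → Injective _≡_ _≡_ (pack {m} {n} {k})
pack-injective {m} {n} {k} {x} {y} eq = cases x y (join-injective eq)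
  where
    encode : (Fin m × Fin n) ⊎ Fin k → Fin (m ℕ.* n) ⊎ Fin k
    encode (inj₁ (i , j)) = inj₁ (combine i j)
    encode (inj₂ i)       = inj₂ i

    join-encode : ∀ x → pack x ≡ Fin.join (m ℕ.* n) k (encode x)
    join-encode (inj₁ _) = ≡.refl
    join-encode (inj₂ _) = ≡.refl

    join-injective : pack x ≡ pack y → encode x ≡ encode y
    join-injective e = ≡.trans (≡.sym (Finₚ.splitAt-join (m ℕ.* n) k (encode x)))
      (≡.trans (≡.cong (Fin.splitAt (m ℕ.* n)) (≡.trans (≡.sym (join-encode x)) (≡.trans e (join-encode y))))
        (Finₚ.splitAt-join (m ℕ.* n) k (encode y)))

    cases : ∀ x y → encode x ≡ encode y → x ≡ y
    cases (inj₁ (i , j)) (inj₁ (i′ , j′)) e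
      with ≡.refl , ≡.refl ← Finₚ.combine-injective i j i′ j′ (inj₁-injective e) = ≡.refl
    cases (inj₂ i)       (inj₂ .i)        ≡.refl = ≡.refl

-- Here w is the exact size of W and e its index, while l only bounds the size of L, since `elemᴸ`
-- may repeat values.
record SubgroupPair {c ℓ Q} (K : FiniteField c ℓ Q) h h′ (w l e : ℕ) :
  Set (c ⊔ ℓ ⊔ Level.suc (h ⊔ h′)) where
  open FiniteField K hiding (zero)
  field
    𝕎 : DecSubgroup commutativeRing h
    𝕃 : DecSubgroup commutativeRing h′

  open DecSubgroup 𝕎 public using () renaming (H to W)
  open DecSubgroup 𝕃 public using () renaming (H to L)

  field
    W*W⊆L           : ∀ {x y} → W x → W y → L (x * y)
    L-halve         : ∀ {x} → L (x + x) → L x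
    w-nonZero       : NonZero w
    Q≡e*w           : Q ≡ e ℕ.* w
    elemᵂ           : Fin w → Carrier
    elemᵂ-injective : Injective _≡_ _≈_ elemᵂ
    elemᵂ∈W         : ∀ v → W (elemᵂ v)
    indexᵂ          : ∀ {x} → W x → ∃ λ v → x ≈ elemᵂ v
    elemᴸ           : Fin l → Carrier
    indexᴸ          : ∀ {x} → L x → ∃ λ v → x ≈ elemᴸ v

module SubgroupColouring {c ℓ Q h h′ w l e} (K : FiniteField c ℓ Q)
  (S : SubgroupPair K h h′ w l e) where

  open FiniteField K hiding (zero)
  open SubgroupPair S
  open FiniteFieldProperties K
  open IntegerRingSolver commutativeRing
  open Algebra.Properties.AbelianGroup +-abelianGroup using (∙-cancelˡ)
  open Algebra.Properties.Ring ring using (-‿involutive)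
  private
    module W = DecSubgroup 𝕎
    module L = DecSubgroup 𝕃

  private
    -- Decodes sums: x + v with v ∈ W determines the coset of x. Once x itself is known, `cancelSum`
    -- recovers v.
    sameSum : ∀ {x y} v u → x + elemᵂ v ≈ y + elemᵂ u → W (x - y)
    sameSum {x} {y} v u eq = W.resp
      (begin
        elemᵂ u - elemᵂ v
          ≈⟨ solve 3 (λ x v u → u :- v := (x :+ u) :- (x :+ v)) refl x (elemᵂ v) (elemᵂ u) ⟩
        (x + elemᵂ u) - (x + elemᵂ v)
          ≈⟨ +-congˡ (-‿cong eq) ⟩
        (x + elemᵂ u) - (y + elemᵂ u)
          ≈⟨ solve 3 (λ x y u → (x :+ u) :- (y :+ u) := x :- y) refl x y (elemᵂ u) ⟩
        x - y ∎)
      (W.H-+ (elemᵂ∈W u) (W.H-neg (elemᵂ∈W v)))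
      where open Relation.Binary.Reasoning.Setoid setoid

    cancelSum : ∀ {x y} v u → x ≈ y → x + elemᵂ v ≈ y + elemᵂ u → v ≡ u
    cancelSum {x} {y} v u x≈y eq = elemᵂ-injective
      (∙-cancelˡ x (elemᵂ v) (elemᵂ u) (trans eq (+-congʳ (sym x≈y))))

  -- Let d₀ be the chosen element of the coset d + W among the listed d. Then
  -- b = d - d₀ ∈ W satisfies b d₀ ∈ L, and (d , v) is recovered from d₀ + v,
  -- hence from (b , b (d₀ + v)) ∈ W × L unless b = 0.
  fewSquaresInL : ∀ {n} (pt : Fin n → Carrier) → Injective _≡_ _≈_ pt →
    (∀ i → L (pt i * pt i)) → n ℕ.≤ e ℕ.+ l
  fewSquaresInL {n} pt pt-inj sq = ℕₚ.*-cancelʳ-≤ n (e ℕ.+ l) w {{w-nonZero}} (begin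
    -- Coupling each d with all of W is what makes the count sharp: the pairs in W × L contribute w
    -- l and the representatives at most Q = e w, so cancelling w leaves e + l.
    n ℕ.* w                ≤⟨ injective⇒*≤ {f = pack ∘ pairCode} (pairCode-injective ∘ pack-injective) ⟩
    w ℕ.* l ℕ.+ Q          ≡⟨ ℕₚ.+-comm (w ℕ.* l) Q ⟩
    Q ℕ.+ w ℕ.* l          ≡⟨ ≡.cong₂ ℕ._+_ Q≡e*w (ℕₚ.*-comm w l) ⟩
    e ℕ.* w ℕ.+ l ℕ.* w    ≡⟨ ℕₚ.*-distribʳ-+ w e l ⟨
    (e ℕ.+ l) ℕ.* w        ∎)
    where
      open ℕₚ.≤-Reasoning
      open Quotient (W.cosets pt)

      base diff : Fin n → Carrier
      base i = pt (rep (class i))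
      diff i = pt i - base i

      diff∈W : ∀ i → W (diff i)
      diff∈W i = class-exact (≡.sym (class-rep (class i)))

      value : Fin n → Fin w → Carrier
      value i v = diff i * (base i + elemᵂ v)

      diff*base∈L : ∀ i → L (diff i * base i)
      -- With b = d - d₀, the identity 2 b d₀ = d² - d₀² - b² has all three squares in L: two by
      -- hypothesis, b² by W W ⊆ L.
      diff*base∈L i = L-halve (L.resp
        (solve 2 (λ d a → (d :* d :+ :- (a :* a)) :+ :- ((d :- a) :* (d :- a))
                            := (d :- a) :* a :+ (d :- a) :* a) refl (pt i) (base i))
        (L.H-+ (L.H-+ (sq i) (L.H-neg (sq _))) (L.H-neg (W*W⊆L (diff∈W i) (diff∈W i)))))

      abstract
        value∈L : ∀ i v → L (value i v)
        value∈L i v = L.resp (sym (distribˡ (diff i) (base i) (elemᵂ v)))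
          (L.H-+ (diff*base∈L i) (W*W⊆L (diff∈W i) (elemᵂ∈W v)))

      code : ∀ i → Dec (rep (class i) ≡ i) → Fin w → (Fin w × Fin l) ⊎ Fin Q
      code i (yes _) v = inj₂ (E.to (pt i + elemᵂ v))
      code i (no _)  v = inj₁ (proj₁ (indexᵂ (diff∈W i)) , proj₁ (indexᴸ (value∈L i v)))

      code-injective : ∀ i j i? j? v u → code i i? v ≡ code j j? u → i ≡ j × v ≡ u
      code-injective i j (yes ri) (yes rj) v u eq = i≡j , cancelSum v u (reflexive (≡.cong pt i≡j)) sum≈
        where
          sum≈ : pt i + elemᵂ v ≈ pt j + elemᵂ u
          sum≈ = to-injective (inj₂-injective eq)
          i≡j : i ≡ j
          i≡j = ≡.trans (≡.sym ri) (≡.trans (≡.cong rep (class-cong (sameSum v u sum≈))) rj)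
      code-injective i j (no ri) (no rj) v u eq = i≡j , cancelSum v u base≈ sum≈
        where
          indices = ,-injective (inj₁-injective eq)

          diff≈ : diff i ≈ diff j
          diff≈ = trans (proj₂ (indexᵂ (diff∈W i))) (trans (reflexive (≡.cong elemᵂ (proj₁ indices)))
            (sym (proj₂ (indexᵂ (diff∈W j)))))

          value≈ : value i v ≈ value j u
          value≈ = trans (proj₂ (indexᴸ (value∈L i v))) (trans (reflexive (≡.cong elemᴸ (proj₂ indices)))
            (sym (proj₂ (indexᴸ (value∈L j u)))))

          -- Here i is not the representative of its class, so b is nonzero by injectivity of `pt`
          -- and cancels from b (d₀ + v).
          sum≈ : base i + elemᵂ v ≈ base j + elemᵂ u
          sum≈ = cancelˡ (λ z → ri (≡.sym (pt-inj (minus-zero z)))) (trans value≈ (*-congʳ (sym diff≈)))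

          class≡ : class i ≡ class j
          class≡ = ≡.trans (≡.sym (class-rep _)) (≡.trans (class-cong (sameSum v u sum≈)) (class-rep _))

          base≈ : base i ≈ base j
          base≈ = reflexive (≡.cong (pt ∘ rep) class≡)

          i≡j : i ≡ j
          i≡j = pt-inj (trans (solve 2 (λ x y → x := (x :- y) :+ y) refl (pt i) (base i))
            (trans (+-cong diff≈ base≈) (solve 2 (λ x y → (x :- y) :+ y := x) refl (pt j) (base j))))
      code-injective i j (yes _) (no _) v u eq = contradiction eq λ ()
      code-injective i j (no _) (yes _) v u eq = contradiction eq λ ()

      pairCode : Fin n × Fin w → (Fin w × Fin l) ⊎ Fin Q
      pairCode (i , v) = code i (rep (class i) Finₚ.≟ i) v

      pairCode-injective : Injective _≡_ _≡_ pairCode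
      pairCode-injective {i , v} {j , u} eq = ≡.cong₂ _,_ (proj₁ parts) (proj₂ parts)
        where
          parts = code-injective i j (rep (class i) Finₚ.≟ i) (rep (class j) Finₚ.≟ j) v u eq

  -- The two palettes and the proper colouring built from them.

  module 𝔾 = FiniteGraph (G K)
  open 𝔾 using (Vertex; Adjacent; Adjacent-resp; Adjacent-sym; Adjacent-irr; adjacent?)

  height : Vertex → Carrier
  height (x₁ , x₂) = x₂ - (x₁ * x₁ + x₁ * x₁)

  -- The term 2x₁² in `height` is chosen for (x + y)² - 2x² - 2y² = -(x - y)². First coordinates
  -- then enter only through their difference, which cosets of W control.
  height-adjacent : ∀ {x y} → Adjacent x y →
    height x + height y ≈ - ((proj₁ x - proj₁ y) * (proj₁ x - proj₁ y))
  height-adjacent {x₁ , x₂} {y₁ , y₂} (_ , eq) = trans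
    (solve 4 (λ x z y t → (z :- (x :* x :+ x :* x)) :+ (t :- (y :* y :+ y :* y))
                            := (z :+ t) :- (x :* x :+ x :* x :+ (y :* y :+ y :* y))) refl x₁ x₂ y₁ y₂)
    (trans (+-congʳ (sym eq))
      (solve 2 (λ x y → (x :+ y) :* (x :+ y) :- (x :* x :+ x :* x :+ (y :* y :+ y :* y))
                          := :- ((x :- y) :* (x :- y))) refl x₁ y₁))

  private
    module V = Inverse 𝔾.enumeration

    vertex : Fin (Q ℕ.* Q) → Vertex
    vertex = V.from

    degree : ℕ
    degree = suc (e ℕ.+ l)

    Low : Rel (Fin (Q ℕ.* Q)) _
    Low i j = Adjacent (vertex i) (vertex j) × L (height (vertex i)) × L (height (vertex j))

    -- Adjacency to a fixed vertex determines the second coordinate from the first, so distinct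
    -- neighbours give distinct d, all with d² ∈ L. `degree` exceeds the possible number of these by
    -- one.
    few : ∀ i → ¬ ∃ λ (g : Fin degree → Fin (Q ℕ.* Q)) → Injective _≡_ _≡_ g × ∀ k → Low i (g k)
    few i (g , g-inj , low) = ℕₚ.1+n≰n (fewSquaresInL pt pt-inj square)
      where
        pt : Fin degree → Carrier
        pt k = proj₁ (vertex i) - proj₁ (vertex (g k))

        square : ∀ k → L (pt k * pt k)
        square k = L.resp
          (trans (-‿cong (height-adjacent {vertex i} {vertex (g k)} (proj₁ (low k))))
            (-‿involutive (pt k * pt k)))
          (L.H-neg (L.H-+ (proj₁ (proj₂ (low k))) (proj₂ (proj₂ (low k)))))

        pt-inj : Injective _≡_ _≈_ pt
        pt-inj {k} {m} eq = g-inj (≡.trans (≡.sym (V.strictlyInverseˡ (g k)))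
          (≡.trans (V.to-cong (first , second)) (V.strictlyInverseˡ (g m))))
          where
            x = vertex i
            y = vertex (g k)
            z = vertex (g m)
            first : proj₁ y ≈ proj₁ z
            first = trans (solve 2 (λ x y → y := x :- (x :- y)) refl (proj₁ x) (proj₁ y))
              (trans (+-congˡ (-‿cong eq)) (solve 2 (λ x y → x :- (x :- y) := y) refl (proj₁ x) (proj₁ z)))
            second : proj₂ y ≈ proj₂ z
            second = ∙-cancelˡ (proj₂ x) _ _
              (trans (sym (proj₂ (proj₁ (low k))))
                (trans (*-cong (+-congˡ first) (+-congˡ first)) (proj₂ (proj₁ (low m)))))

    lowColouring = greedyColouring (Q ℕ.* Q) degree
      (λ i j → adjacent? (vertex i) (vertex j) ×-dec
        L.H? (height (vertex i)) ×-dec L.H? (height (vertex j)))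
      (λ {i} {j} (adj , Li , Lj) → Adjacent-sym {vertex i} {vertex j} adj , Lj , Li)
      (λ { {i} ≡.refl (adj , _) → Adjacent-irr {vertex i} {vertex i} (refl , refl) adj })
      few

    module W/ = Quotient (W.cosets E.from)
    module L/ = Quotient (L.cosets E.from)

    -- The translates of W by the representatives are disjoint, so together they have at most Q = e
    -- w elements.
    sizeᵂ≤e : W/.size ℕ.≤ e
    sizeᵂ≤e = ℕₚ.*-cancelʳ-≤ W/.size e w {{w-nonZero}}
      (ℕₚ.≤-trans (injective⇒*≤ {f = translate} translate-injective) (ℕₚ.≤-reflexive Q≡e*w))
      where
        translate : Fin W/.size × Fin w → Fin Q
        translate (r , v) = E.to (E.from (W/.rep r) + elemᵂ v)

        shift-injective : ∀ r v s u →
          E.from (W/.rep r) + elemᵂ v ≈ E.from (W/.rep s) + elemᵂ u → r ≡ s × v ≡ u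
        shift-injective r v s u eq =
          r≡s , cancelSum v u (reflexive (≡.cong (E.from ∘ W/.rep) r≡s)) eq
          where
            r≡s : r ≡ s
            r≡s = ≡.trans (≡.sym (W/.class-rep r))
              (≡.trans (W/.class-cong (sameSum v u eq)) (W/.class-rep s))

        translate-injective : Injective _≡_ _≡_ translate
        translate-injective {r , v} {s , u} eq = ≡.cong₂ _,_ (proj₁ parts) (proj₂ parts)
          where
            parts = shift-injective r v s u (to-injective eq)

    -- The sign of z: negation exchanges the two cosets being compared, and the numbering of cosets
    -- supplies the order.
    side : Carrier → Fin 2
    side z = order (L/.class (E.to z) Finₚ.<? L/.class (E.to (- z)))

    L/-cong : ∀ {x y} → L (x - y) → L/.class (E.to x) ≡ L/.class (E.to y)
    L/-cong d = L/.class-cong (L.resp (+-cong (sym (from-to _)) (-‿cong (sym (from-to _)))) d)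

    -- Modulo L, z′ is -z, so the comparison for z′ has its two sides exchanged. Equal answers would
    -- put z and -z in one coset, hence 2z and then z in L.
    side-differs : ∀ {z z′} → ¬ L z → L (z + z′) → side z ≢ side z′
    side-differs {z} {z′} z∉L sum eq = z∉L (L-halve (L.resp
      (trans (+-cong (from-to z) (-‿cong (from-to (- z)))) (+-congˡ (-‿involutive z)))
      (L/.class-exact (order-antisym (L/.class (E.to z)) (L/.class (E.to (- z))) (≡.trans eq
        (≡.cong₂ (λ a b → order (a Finₚ.<? b))
          (L/-cong (L.resp (solve 2 (λ x y → x :+ y := y :- (:- x)) refl z z′) sum))
          (L/-cong (L.resp (solve 2 (λ x y → :- (x :+ y) := (:- y) :- x) refl z z′) (L.H-neg sum)))))))))

    colours : ℕ
    colours = 2 ℕ.* e ℕ.+ degree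

    paint : ∀ i → Dec (L (height (vertex i))) → (Fin 2 × Fin e) ⊎ Fin degree
    paint i (yes _) = inj₂ (proj₁ lowColouring i)
    paint i (no _)  = inj₁ (side (height (vertex i)) ,
      Fin.inject≤ (W/.class (E.to (proj₁ (vertex i)))) sizeᵂ≤e)

    paint-proper : ∀ i j i? j? → Adjacent (vertex i) (vertex j) → paint i i? ≢ paint j j?
    paint-proper i j (yes Li) (yes Lj) adj eq = proj₂ lowColouring (adj , Li , Lj) (inj₂-injective eq)
    paint-proper i j (yes _) (no _) adj eq = contradiction eq λ ()
    paint-proper i j (no _) (yes _) adj eq = contradiction eq λ ()
    paint-proper i j (no ¬Li) (no ¬Lj) adj eq =
      -- A common coset of W puts (x - x′)² into L, so the two heights have their sum in L.
      side-differs ¬Li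
        (L.resp (sym (height-adjacent {vertex i} {vertex j} adj)) (L.H-neg (W*W⊆L d∈W d∈W)))
        (proj₁ colours≡)
      where
        colours≡ = ,-injective (inj₁-injective eq)

        d∈W : W (proj₁ (vertex i) - proj₁ (vertex j))
        d∈W = W.resp (+-cong (from-to _) (-‿cong (from-to _)))
          (W/.class-exact (Finₚ.inject≤-injective sizeᵂ≤e sizeᵂ≤e _ _ (proj₂ colours≡)))

    colour : Fin (Q ℕ.* Q) → Fin colours
    colour i = pack (paint i (L.H? (height (vertex i))))

  colouring : Colouring (G K) (2 ℕ.* e ℕ.+ suc (e ℕ.+ l))
  colouring = record
    { colour = record { to = colour ∘ V.to ; cong = ≡.cong colour ∘ V.to-cong }
    ; proper = λ {u} {v} adj eq → paint-proper (V.to u) (V.to v)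
        (L.H? (height (vertex (V.to u)))) (L.H? (height (vertex (V.to v))))
        (proj₁ (Adjacent-resp) {_} {_} {_} (≈-sym {vertex (V.to v)} {v} (V.strictlyInverseʳ v))
          (proj₂ (Adjacent-resp) {_} {_} {_} (≈-sym {vertex (V.to u)} {u} (V.strictlyInverseʳ u)) adj))
        (pack-injective eq)
    }
    where
      ≈-sym : ∀ {x y} → x 𝔾.≈ y → y 𝔾.≈ x
      ≈-sym (a , b) = sym a , sym b

  χ-bound : χ (G K) ℕ.≤ 2 ℕ.* e ℕ.+ suc (e ℕ.+ l)
  χ-bound = proj₂ (proj₂ (hasChromaticNumber (G K))) _ colouring

-- Fields of prime power order

odd-prime : ∀ {p} → Prime p → p ≢ 2 → ∃ λ h → p ≡ suc (h ℕ.+ h)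
odd-prime {p} p-prime p≢2 with p ℕ.% 2 in r≡ | DivMod.m≡m%n+[m/n]*n p 2 | DivMod.m%n<n p 2
... | 0 | p≡ | _ with prime⇒irreducible p-prime (m%n≡0⇒n∣m p 2 r≡)
...   | inj₂ 2≡p = contradiction (≡.sym 2≡p) p≢2
odd-prime {p} p-prime p≢2 | 1 | p≡ | _ = p ℕ./ 2 , ≡.trans p≡ (≡.cong suc (double (p ℕ./ 2)))
  where
    double : ∀ h → h ℕ.* 2 ≡ h ℕ.+ h
    double h = ≡.trans (ℕₚ.*-comm h 2) (≡.cong (h ℕ.+_) (ℕₚ.+-identityʳ h))
odd-prime p-prime p≢2 | suc (suc _) | _ | s≤s (s≤s ())

n<p^n : ∀ {p} → 1 ℕ.< p → ∀ n → n ℕ.< p ℕ.^ n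
n<p^n 1<p zero    = ℕ.z<s
n<p^n {p} 1<p (suc n) = ℕₚ.≤-<-trans (n<p^n 1<p n) (ℕₚ.^-monoʳ-< p 1<p (ℕₚ.n<1+n n))

module _ {c ℓ Q} (K : FiniteField c ℓ Q) where
  open FiniteField K using (commutativeRing; semiring; _≈_; _+_; 0#; 1#)
  open Algebra.Properties.Semiring.Mult semiring using () renaming (_×_ to _·_)
  open FiniteFieldProperties K

  -- E is the codimension of W over the prime field. The condition s ≤ E secures β: it gives s < p^s
  -- ≤ p^E, so p^s s < Q.
  χ-primePower : ∀ {p} → Prime p → p ≢ 2 → ∀ E σ → Q ≡ p ℕ.^ (E ℕ.+ suc σ) → suc σ ℕ.≤ E →
    χ (G K) ℕ.≤ 2 ℕ.* p ℕ.^ E ℕ.+ suc (p ℕ.^ E ℕ.+ p ℕ.^ (suc σ ℕ.+ σ))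
  χ-primePower {p} p-prime p≢2 E σ Q≡ s≤E = SubgroupColouring.χ-bound K pair
    where
      instance
        p≢0 : NonZero p
        p≢0 = prime⇒nonZero p-prime

      1<p : 1 ℕ.< p
      1<p = ℕ.nonTrivial⇒n>1 p {{prime⇒nonTrivial p-prime}}

      s = suc σ
      h = proj₁ (odd-prime p-prime p≢2)
      p≈0 = characteristic p (E ℕ.+ s) Q≡

      open Characteristic p p-prime p≈0

      Q≡p^E*p^s : Q ≡ p ℕ.^ E ℕ.* p ℕ.^ s
      Q≡p^E*p^s = ≡.trans Q≡ (ℕₚ.^-distribˡ-+-* p E s)

      small : p ℕ.^ s ℕ.* s ℕ.< Q
      small = begin-strict
        p ℕ.^ s ℕ.* s        <⟨ ℕₚ.*-monoʳ-< (p ℕ.^ s) {{ℕₚ.m^n≢0 p s}}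
                                  (ℕₚ.<-≤-trans (n<p^n 1<p s) (ℕₚ.^-monoʳ-≤ p s≤E)) ⟩
        p ℕ.^ s ℕ.* p ℕ.^ E  ≡⟨ ℕₚ.*-comm (p ℕ.^ s) (p ℕ.^ E) ⟩
        p ℕ.^ E ℕ.* p ℕ.^ s  ≡⟨ ≡.sym Q≡p^E*p^s ⟩
        Q                    ∎
        where open ℕₚ.≤-Reasoning

      β = proj₁ (independentElement s small)

      span : ℕ → DecSubgroup commutativeRing _
      span n = record
        { H = Span β n ; H? = span? β n ; resp = span-resp
        ; H-0 = span-0 n ; H-+ = span-+ ; H-neg = span-neg }

      L-halves : ∀ {x} → Span β (s ℕ.+ σ) (x + x) → Span β (s ℕ.+ σ) x
      L-halves = DecSubgroup.Halving.halve (span (s ℕ.+ σ)) h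
        (≡.subst (λ k → k · 1# ≈ 0#) (proj₂ (odd-prime p-prime p≢2)) p≈0)

      pair : SubgroupPair K _ _ (p ℕ.^ s) (p ℕ.^ (s ℕ.+ σ)) (p ℕ.^ E)
      pair = record
        { 𝕎               = span s
        ; 𝕃               = span (s ℕ.+ σ)
        ; W*W⊆L           = span-*
        ; L-halve         = L-halves
        ; w-nonZero       = ℕₚ.m^n≢0 p s
        ; Q≡e*w           = Q≡p^E*p^s
        ; elemᵂ           = combination s β
        ; elemᵂ-injective = combination-injective (proj₂ (independentElement s small))
        ; elemᵂ∈W         = λ v → span-eval β (digit s v)
        ; indexᵂ          = span-index
        ; elemᴸ           = combination (s ℕ.+ σ) β
        ; indexᴸ          = span-index
        }

-- The numerical bound

module _ where
  open import Relation.Binary.Reasoning.Setoid ℚᵘₚ.≃-setoid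

  toℚᵘ-fromℕ : ∀ n → toℚᵘ (fromℕ n) ℚᵘ.≃ mkℚᵘ (+ n) 0
  toℚᵘ-fromℕ n = ℚₚ.toℚᵘ-fromℚᵘ (mkℚᵘ (+ n) 0)

  fromℕ-* : ∀ m n → fromℕ (m ℕ.* n) ≡ fromℕ m ℚ.* fromℕ n
  fromℕ-* m n = ℚₚ.toℚᵘ-injective (begin
    toℚᵘ (fromℕ (m ℕ.* n))                 ≈⟨ toℚᵘ-fromℕ (m ℕ.* n) ⟩
    mkℚᵘ (+ (m ℕ.* n)) 0                   ≈⟨ *≡* (≡.cong (ℤ._* + 1) (ℤₚ.pos-* m n)) ⟩
    mkℚᵘ (+ m) 0 ℚᵘ.* mkℚᵘ (+ n) 0         ≈⟨ ℚᵘₚ.*-cong (toℚᵘ-fromℕ m) (toℚᵘ-fromℕ n) ⟨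
    toℚᵘ (fromℕ m) ℚᵘ.* toℚᵘ (fromℕ n)     ≈⟨ ℚₚ.toℚᵘ-homo-* (fromℕ m) (fromℕ n) ⟨
    toℚᵘ (fromℕ m ℚ.* fromℕ n)             ∎)

  fromℕ-+ : ∀ m n → fromℕ (m ℕ.+ n) ≡ fromℕ m ℚ.+ fromℕ n
  fromℕ-+ m n = ℚₚ.toℚᵘ-injective (begin
    toℚᵘ (fromℕ (m ℕ.+ n))                 ≈⟨ toℚᵘ-fromℕ (m ℕ.+ n) ⟩
    mkℚᵘ (+ (m ℕ.+ n)) 0                   ≈⟨ *≡* (≡.cong (ℤ._* + 1) pos-+) ⟩
    mkℚᵘ (+ m) 0 ℚᵘ.+ mkℚᵘ (+ n) 0         ≈⟨ ℚᵘₚ.+-cong (toℚᵘ-fromℕ m) (toℚᵘ-fromℕ n) ⟨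
    toℚᵘ (fromℕ m) ℚᵘ.+ toℚᵘ (fromℕ n)     ≈⟨ ℚₚ.toℚᵘ-homo-+ (fromℕ m) (fromℕ n) ⟨
    toℚᵘ (fromℕ m ℚ.+ fromℕ n)             ∎)
    where
      pos-+ : + (m ℕ.+ n) ≡ + m ℤ.* + 1 ℤ.+ + n ℤ.* + 1
      pos-+ = ≡.trans (ℤₚ.pos-+ m n)
        (≡.sym (≡.cong₂ ℤ._+_ (ℤₚ.*-identityʳ (+ m)) (ℤₚ.*-identityʳ (+ n))))

  3*[n/3] : ∀ n → fromℕ 3 ℚ.* (+ n ℚ./ 3) ≡ fromℕ n
  3*[n/3] n = ℚₚ.toℚᵘ-injective (begin
    toℚᵘ (fromℕ 3 ℚ.* (+ n ℚ./ 3))            ≈⟨ ℚₚ.toℚᵘ-homo-* (fromℕ 3) (+ n ℚ./ 3) ⟩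
    toℚᵘ (fromℕ 3) ℚᵘ.* toℚᵘ (+ n ℚ./ 3)      ≈⟨ ℚᵘₚ.*-cong (toℚᵘ-fromℕ 3) (ℚₚ.toℚᵘ-fromℚᵘ (mkℚᵘ (+ n) 2)) ⟩
    mkℚᵘ (+ 3) 0 ℚᵘ.* mkℚᵘ (+ n) 2            ≈⟨ *≡* (≡.trans (ℤₚ.*-identityʳ _) (ℤₚ.*-comm (+ 3) (+ n))) ⟩
    mkℚᵘ (+ n) 0                              ≈⟨ toℚᵘ-fromℕ n ⟨
    toℚᵘ (fromℕ n)                            ∎)

fromℕ-mono : ∀ {m n} → m ℕ.≤ n → fromℕ m ℚ.≤ fromℕ n
fromℕ-mono {m} {n} m≤n = ℚₚ.toℚᵘ-cancel-≤ (ℚᵘₚ.≤-respˡ-≃ (ℚᵘₚ.≃-sym (toℚᵘ-fromℕ m))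
  (ℚᵘₚ.≤-respʳ-≃ (ℚᵘₚ.≃-sym (toℚᵘ-fromℕ n)) (*≤* (ℤₚ.*-monoʳ-≤-nonNeg (+ 1) (ℤ.+≤+ m≤n)))))

-- By contraposition from y < x: for y ≥ 0 the cubes compare factor by factor, and for y ≤ 0 one has
-- y³ ≤ 0 < x³.
cube-cancel-≤ : ∀ x y → .{{ℚ.Positive x}} → x ℚ.* x ℚ.* x ℚ.≤ y ℚ.* y ℚ.* y → x ℚ.≤ y
cube-cancel-≤ x y x³≤y³ = ℚₚ.≮⇒≥ λ y<x →
  ℚₚ.<-irrefl ≡.refl (ℚₚ.<-≤-trans (cube-< y<x (ℚₚ.≤-total ℚ.0ℚ y)) x³≤y³)
  where
    open ℚₚ.≤-Reasoning
    instance
      x≥0 : ℚ.NonNegative x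
      x≥0 = ℚₚ.pos⇒nonNeg x
      x²>0 : ℚ.Positive (x ℚ.* x)
      x²>0 = ℚₚ.pos*pos⇒pos x x

    cube-< : y ℚ.< x → ℚ.0ℚ ℚ.≤ y ⊎ y ℚ.≤ ℚ.0ℚ → y ℚ.* y ℚ.* y ℚ.< x ℚ.* x ℚ.* x
    cube-< y<x (inj₁ 0≤y) = begin-strict
      y ℚ.* y ℚ.* y  ≤⟨ ℚₚ.*-monoʳ-≤-nonNeg y y²≤x² ⟩
      x ℚ.* x ℚ.* y  <⟨ ℚₚ.*-monoʳ-<-pos (x ℚ.* x) y<x ⟩
      x ℚ.* x ℚ.* x  ∎
      where
        instance
          y≥0 : ℚ.NonNegative y
          y≥0 = ℚ.nonNegative 0≤y
        y²≤x² : y ℚ.* y ℚ.≤ x ℚ.* x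
        y²≤x² = ℚₚ.≤-trans (ℚₚ.*-monoʳ-≤-nonNeg y (ℚₚ.<⇒≤ y<x)) (ℚₚ.*-monoˡ-≤-nonNeg x (ℚₚ.<⇒≤ y<x))
    cube-< y<x (inj₂ y≤0) = begin-strict
      y ℚ.* y ℚ.* y  ≤⟨ ℚₚ.nonPositive⁻¹ (y ℚ.* y ℚ.* y) {{ℚₚ.nonNeg*nonPos⇒nonPos (y ℚ.* y) y}} ⟩
      ℚ.0ℚ           <⟨ ℚₚ.positive⁻¹ (x ℚ.* x ℚ.* x) {{ℚₚ.pos*pos⇒pos (x ℚ.* x) x}} ⟩
      x ℚ.* x ℚ.* x  ∎
      where
        instance
          y≤0′ : ℚ.NonPositive y
          y≤0′ = ℚ.nonPositive y≤0
          y²≥0 : ℚ.NonNegative (y ℚ.* y)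
          y²≥0 = ℚₚ.nonPos*nonPos⇒nonPos y y

-- N / 7 is at most the real cube root of m, hence at most y.
cubeRoot-bound : ∀ {N m y} → 1 ℕ.≤ N → N ℕ.* N ℕ.* N ℕ.≤ 343 ℕ.* m → y ≥∛ m →
  fromℕ N ℚ.≤ fromℕ 7 ℚ.* y
cubeRoot-bound {N} {m} {y} 1≤N N³≤ m≤y³ = cube-cancel-≤ (fromℕ N) (fromℕ 7 ℚ.* y)
  {{ℚ.positive (ℚₚ.<-≤-trans {j = fromℕ 1} (ℚₚ.positive⁻¹ ℚ.1ℚ) (fromℕ-mono 1≤N))}} (begin
    fromℕ N ℚ.* fromℕ N ℚ.* fromℕ N
      ≡⟨ ≡.trans (fromℕ-* (N ℕ.* N) N) (≡.cong (ℚ._* fromℕ N) (fromℕ-* N N)) ⟨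
    fromℕ (N ℕ.* N ℕ.* N)
      ≤⟨ fromℕ-mono N³≤ ⟩
    fromℕ (343 ℕ.* m)
      ≡⟨ fromℕ-* 343 m ⟩
    fromℕ 343 ℚ.* fromℕ m
      ≤⟨ ℚₚ.*-monoˡ-≤-nonNeg (fromℕ 343) m≤y³ ⟩
    fromℕ 343 ℚ.* (y ℚ.* y ℚ.* y)
      ≡⟨ ℚSolver.solve 2 (λ c y → (c :* c :* c) :* (y :* y :* y) := (c :* y) :* (c :* y) :* (c :* y))
           ≡.refl (fromℕ 7) y ⟩
    fromℕ 7 ℚ.* y ℚ.* (fromℕ 7 ℚ.* y) ℚ.* (fromℕ 7 ℚ.* y) ∎)
  where
    open ℚₚ.≤-Reasoning
    module ℚSolver = IntegerRingSolver ℚₚ.+-*-commutativeRing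
    open ℚSolver using (_:*_; _:=_)

-- Tripled to clear the denominator: 3x ≤ 3a + 3, where 3a ≤ 7y ≤ T y and 3 ≤ 3Z.
real-bound : ∀ {x a m T Z y} → x ℕ.≤ suc a → 1 ℕ.≤ a → 7 ℕ.≤ T → 1 ℕ.≤ Z →
  (3 ℕ.* a) ℕ.* (3 ℕ.* a) ℕ.* (3 ℕ.* a) ℕ.≤ 343 ℕ.* m → y ≥∛ m →
  fromℕ x ℚ.≤ (+ T ℚ./ 3) ℚ.* y ℚ.+ fromℕ Z
real-bound {x} {a} {m} {T} {Z} {y} x≤ 1≤a 7≤T 1≤Z cubes y≥∛m = ℚₚ.*-cancelˡ-≤-pos (fromℕ 3) (begin
  fromℕ 3 ℚ.* fromℕ x
    ≡⟨ fromℕ-* 3 x ⟨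
  fromℕ (3 ℕ.* x)
    ≤⟨ fromℕ-mono 3x≤ ⟩
  fromℕ (3 ℕ.* a ℕ.+ 3 ℕ.* Z)
    ≡⟨ ≡.trans (fromℕ-+ (3 ℕ.* a) (3 ℕ.* Z)) (≡.cong (fromℕ (3 ℕ.* a) ℚ.+_) (fromℕ-* 3 Z)) ⟩
  fromℕ (3 ℕ.* a) ℚ.+ fromℕ 3 ℚ.* fromℕ Z
    ≤⟨ ℚₚ.+-monoˡ-≤ (fromℕ 3 ℚ.* fromℕ Z) (ℚₚ.≤-trans 3a≤7y (ℚₚ.*-monoʳ-≤-nonNeg y (fromℕ-mono 7≤T))) ⟩
  fromℕ T ℚ.* y ℚ.+ fromℕ 3 ℚ.* fromℕ Z
    ≡⟨ ≡.cong (λ c → c ℚ.* y ℚ.+ fromℕ 3 ℚ.* fromℕ Z) (3*[n/3] T) ⟨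
  fromℕ 3 ℚ.* (+ T ℚ./ 3) ℚ.* y ℚ.+ fromℕ 3 ℚ.* fromℕ Z
    ≡⟨ ≡.cong (ℚ._+ fromℕ 3 ℚ.* fromℕ Z) (ℚₚ.*-assoc (fromℕ 3) (+ T ℚ./ 3) y) ⟩
  fromℕ 3 ℚ.* ((+ T ℚ./ 3) ℚ.* y) ℚ.+ fromℕ 3 ℚ.* fromℕ Z
    ≡⟨ ℚₚ.*-distribˡ-+ (fromℕ 3) ((+ T ℚ./ 3) ℚ.* y) (fromℕ Z) ⟨
  fromℕ 3 ℚ.* ((+ T ℚ./ 3) ℚ.* y ℚ.+ fromℕ Z) ∎)
  where
    open ℚₚ.≤-Reasoning
    3a≤7y : fromℕ (3 ℕ.* a) ℚ.≤ fromℕ 7 ℚ.* y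
    3a≤7y = cubeRoot-bound {3 ℕ.* a} {m} {y} (ℕₚ.≤-trans 1≤a (ℕₚ.m≤n*m a 3)) cubes y≥∛m

    instance
      y≥0 : ℚ.NonNegative y
      -- The sign of y comes from 0 ≤ 3a ≤ 7y; it allows 7 to be replaced by T.
      y≥0 = ℚ.nonNegative (ℚₚ.*-cancelˡ-≤-pos {ℚ.0ℚ} {y} (fromℕ 7)
        (ℚₚ.≤-trans (fromℕ-mono {0} {3 ℕ.* a} z≤n) 3a≤7y))

    3x≤ : 3 ℕ.* x ℕ.≤ 3 ℕ.* a ℕ.+ 3 ℕ.* Z
    3x≤ = ℕₚ.≤-trans (ℕₚ.*-monoʳ-≤ 3 (ℕₚ.≤-trans x≤
        (ℕₚ.≤-trans (ℕₚ.≤-reflexive (ℕₚ.+-comm 1 a)) (ℕₚ.+-monoʳ-≤ a 1≤Z))))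
      (ℕₚ.≤-reflexive (ℕₚ.*-distribˡ-+ 3 a Z))

-- Write a = 3m + i. The subspace dimension 1 + σ ≈ 2a/3 balances the number of
-- cosets p^E against the size p^(1 + 2σ) of the target of squares.
module _ {p : ℕ} (3≤p : 3 ℕ.≤ p) where
  private
    instance
      p≢0 : NonZero p
      p≢0 = ℕ.>-nonZero (ℕₚ.≤-trans (s≤s z≤n) 3≤p)

    open ℕSolver.+-*-Solver using (solve; _:+_; _:*_; _:=_; con)
    open ℕₚ.≤-Reasoning

    -- Y is a power of p with M = p^i Y³, where i is the residue of the exponent of M modulo 3, and
    -- d = 3^i ≤ p^i.
    cubes : ∀ {N Y M} c d → N ℕ.≤ c ℕ.* Y → c ℕ.* c ℕ.* c ℕ.≤ 343 ℕ.* d → d ℕ.* (Y ℕ.* Y ℕ.* Y) ℕ.≤ M →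
      N ℕ.* N ℕ.* N ℕ.≤ 343 ℕ.* M
    cubes {N} {Y} {M} c d N≤ c³≤ ≤M = begin
      N ℕ.* N ℕ.* N
        ≤⟨ ℕₚ.*-mono-≤ (ℕₚ.*-mono-≤ N≤ N≤) N≤ ⟩
      (c ℕ.* Y) ℕ.* (c ℕ.* Y) ℕ.* (c ℕ.* Y)
        ≡⟨ solve 2 (λ c y → (c :* y) :* (c :* y) :* (c :* y) := (c :* c :* c) :* (y :* y :* y)) ≡.refl c Y ⟩
      c ℕ.* c ℕ.* c ℕ.* (Y ℕ.* Y ℕ.* Y)
        ≤⟨ ℕₚ.*-monoˡ-≤ (Y ℕ.* Y ℕ.* Y) c³≤ ⟩
      343 ℕ.* d ℕ.* (Y ℕ.* Y ℕ.* Y)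
        ≡⟨ ℕₚ.*-assoc 343 d _ ⟩
      343 ℕ.* (d ℕ.* (Y ℕ.* Y ℕ.* Y))
        ≤⟨ ℕₚ.*-monoʳ-≤ 343 ≤M ⟩
      343 ℕ.* M ∎

    cube-^ : ∀ E → p ℕ.^ (E ℕ.+ E ℕ.+ E) ≡ p ℕ.^ E ℕ.* p ℕ.^ E ℕ.* p ℕ.^ E
    cube-^ E = ≡.trans (ℕₚ.^-distribˡ-+-* p (E ℕ.+ E) E)
      (≡.cong (ℕ._* p ℕ.^ E) (ℕₚ.^-distribˡ-+-* p E E))

    ^-≤ : ∀ {i j} → i ℕ.≤ j → p ℕ.^ i ℕ.≤ p ℕ.^ j
    ^-≤ = ℕₚ.^-monoʳ-≤ p

  -- For q = p^(k+1) and a = (k+1) r: the degree of K over its prime field splits as E + s, and 3 (3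
  -- p^E + p^(2s-1)) is at most 7 q^(4r/3+1), stated for cubes.
  Balanced : ℕ → ℕ → ℕ → ℕ → Set
  Balanced a k E σ = 2 ℕ.* a ℕ.+ suc k ≡ E ℕ.+ suc σ × suc σ ℕ.≤ E ×
    let N = 3 ℕ.* (3 ℕ.* p ℕ.^ E ℕ.+ p ℕ.^ (suc σ ℕ.+ σ)) in
    N ℕ.* N ℕ.* N ℕ.≤ 343 ℕ.* p ℕ.^ (4 ℕ.* a ℕ.+ 3 ℕ.* suc k)

  private
    -- The cube root is exactly p^(E+1). It absorbs 3 p^E because p ≥ 3, so N is at most 6 times it,
    -- and 6³ = 216 ≤ 343.
    balance₀ : ∀ m k → Balanced (3 ℕ.* suc m) k (4 ℕ.* suc m ℕ.+ k) (2 ℕ.* suc m)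
    balance₀ m k =
      solve 2 (λ m k → con 2 :* (con 3 :* (con 1 :+ m)) :+ (con 1 :+ k)
        := (con 4 :* (con 1 :+ m) :+ k) :+ (con 1 :+ con 2 :* (con 1 :+ m))) ≡.refl m k ,
      ℕₚ.≤-trans (ℕₚ.m≤m+n _ (1 ℕ.+ 2 ℕ.* m ℕ.+ k)) (ℕₚ.≤-reflexive
        (solve 2 (λ m k → (con 1 :+ con 2 :* (con 1 :+ m)) :+ (con 1 :+ con 2 :* m :+ k)
           := con 4 :* (con 1 :+ m) :+ k)
           ≡.refl m k)) ,
      cubes {Y = p ℕ.^ suc E} 6 1 N≤ (ℕₚ.≤ᵇ⇒≤ _ _ tt) (ℕₚ.≤-reflexive
        (≡.trans (ℕₚ.*-identityˡ _) (≡.trans (≡.sym (cube-^ (suc E))) (≡.cong (p ℕ.^_)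
          (solve 2 (λ m k → let E = con 1 :+ (con 4 :* (con 1 :+ m) :+ k) in
             E :+ E :+ E := con 4 :* (con 3 :* (con 1 :+ m)) :+ con 3 :* (con 1 :+ k)) ≡.refl m k)))))
      where
        E = 4 ℕ.* suc m ℕ.+ k
        σ = 2 ℕ.* suc m
        σ≤ : suc σ ℕ.+ σ ℕ.≤ suc E
        σ≤ = ℕₚ.≤-trans (ℕₚ.m≤m+n _ k) (ℕₚ.≤-reflexive
          (solve 2 (λ m k → (con 1 :+ con 2 :* (con 1 :+ m)) :+ con 2 :* (con 1 :+ m) :+ k
             := con 1 :+ (con 4 :* (con 1 :+ m) :+ k))
             ≡.refl m k))
        N≤ : 3 ℕ.* (3 ℕ.* p ℕ.^ E ℕ.+ p ℕ.^ (suc σ ℕ.+ σ)) ℕ.≤ 6 ℕ.* p ℕ.^ suc E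
        N≤ = ℕₚ.≤-trans (ℕₚ.*-monoʳ-≤ 3 (ℕₚ.+-mono-≤ (ℕₚ.*-monoˡ-≤ (p ℕ.^ E) 3≤p) (^-≤ σ≤)))
          (ℕₚ.≤-reflexive (solve 1 (λ y → con 3 :* (y :+ y) := con 6 :* y) ≡.refl (p ℕ.^ suc E)))

    -- The tightest case, which needs the full 7: N ≤ 9P + 3B ≤ 10P, because 3B ≤ p B ≤ P, while the
    -- target is p P³ ≥ 3 P³, and 1000 ≤ 343 · 3 = 1029.
    balance₁ : ∀ m k → Balanced (1 ℕ.+ 3 ℕ.* m) k (2 ℕ.+ 4 ℕ.* m ℕ.+ k) (2 ℕ.* m)
    balance₁ m k =
      solve 2 (λ m k → con 2 :* (con 1 :+ con 3 :* m) :+ (con 1 :+ k)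
        := (con 2 :+ con 4 :* m :+ k) :+ (con 1 :+ con 2 :* m)) ≡.refl m k ,
      ℕₚ.≤-trans (ℕₚ.m≤m+n _ (1 ℕ.+ 2 ℕ.* m ℕ.+ k)) (ℕₚ.≤-reflexive
        (solve 2 (λ m k → (con 1 :+ con 2 :* m) :+ (con 1 :+ con 2 :* m :+ k)
           := con 2 :+ con 4 :* m :+ k)
           ≡.refl m k)) ,
      cubes {Y = P} 10 3 N≤ (ℕₚ.≤ᵇ⇒≤ _ _ tt) (begin
        3 ℕ.* (P ℕ.* P ℕ.* P)          ≤⟨ ℕₚ.*-monoˡ-≤ (P ℕ.* P ℕ.* P) 3≤p ⟩
        p ℕ.* (P ℕ.* P ℕ.* P)          ≡⟨ ≡.cong (p ℕ.*_) (cube-^ E) ⟨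
        p ℕ.^ suc (E ℕ.+ E ℕ.+ E)      ≡⟨ ≡.cong (p ℕ.^_)
          (solve 2 (λ m k → let E = con 2 :+ con 4 :* m :+ k in
             con 1 :+ (E :+ E :+ E) := con 4 :* (con 1 :+ con 3 :* m) :+ con 3 :* (con 1 :+ k)) ≡.refl m k) ⟩
        p ℕ.^ (4 ℕ.* (1 ℕ.+ 3 ℕ.* m) ℕ.+ 3 ℕ.* suc k) ∎)
      where
        E = 2 ℕ.+ 4 ℕ.* m ℕ.+ k
        σ = 2 ℕ.* m
        P = p ℕ.^ E
        B = p ℕ.^ (suc σ ℕ.+ σ)
        σ≤ : suc (suc σ ℕ.+ σ) ℕ.≤ E
        σ≤ = ℕₚ.≤-trans (ℕₚ.m≤m+n _ k) (ℕₚ.≤-reflexive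
          (solve 2 (λ m k → con 1 :+ ((con 1 :+ con 2 :* m) :+ con 2 :* m) :+ k
             := con 2 :+ con 4 :* m :+ k)
             ≡.refl m k))
        N≤ : 3 ℕ.* (3 ℕ.* P ℕ.+ B) ℕ.≤ 10 ℕ.* P
        N≤ = begin
          3 ℕ.* (3 ℕ.* P ℕ.+ B)   ≡⟨ solve 2 (λ P B → con 3 :* (con 3 :* P :+ B) := con 9 :* P :+ con 3 :* B)
                                       ≡.refl P B ⟩
          9 ℕ.* P ℕ.+ 3 ℕ.* B     ≤⟨ ℕₚ.+-monoʳ-≤ (9 ℕ.* P) (ℕₚ.≤-trans (ℕₚ.*-monoˡ-≤ B 3≤p) (^-≤ σ≤)) ⟩
          9 ℕ.* P ℕ.+ P           ≡⟨ ℕₚ.+-comm (9 ℕ.* P) P ⟩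
          10 ℕ.* P                ∎

    -- Here B ≤ P gives N ≤ 12P against p² P³ ≥ 9 P³, and 1728 ≤ 343 · 9 = 3087.
    balance₂ : ∀ m k → Balanced (2 ℕ.+ 3 ℕ.* m) k (3 ℕ.+ 4 ℕ.* m ℕ.+ k) (suc (2 ℕ.* m))
    balance₂ m k =
      solve 2 (λ m k → con 2 :* (con 2 :+ con 3 :* m) :+ (con 1 :+ k)
        := (con 3 :+ con 4 :* m :+ k) :+ (con 2 :+ con 2 :* m)) ≡.refl m k ,
      ℕₚ.≤-trans (ℕₚ.m≤m+n _ (1 ℕ.+ 2 ℕ.* m ℕ.+ k)) (ℕₚ.≤-reflexive
        (solve 2 (λ m k → (con 2 :+ con 2 :* m) :+ (con 1 :+ con 2 :* m :+ k)
           := con 3 :+ con 4 :* m :+ k)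
           ≡.refl m k)) ,
      cubes {Y = P} 12 9 N≤ (ℕₚ.≤ᵇ⇒≤ _ _ tt) (begin
        9 ℕ.* (P ℕ.* P ℕ.* P)          ≤⟨ ℕₚ.*-monoˡ-≤ (P ℕ.* P ℕ.* P) (ℕₚ.*-mono-≤ 3≤p 3≤p) ⟩
        p ℕ.* p ℕ.* (P ℕ.* P ℕ.* P)    ≡⟨ ℕₚ.*-assoc p p _ ⟩
        p ℕ.* (p ℕ.* (P ℕ.* P ℕ.* P))  ≡⟨ ≡.cong (λ x → p ℕ.* (p ℕ.* x)) (cube-^ E) ⟨
        p ℕ.^ (2 ℕ.+ (E ℕ.+ E ℕ.+ E))  ≡⟨ ≡.cong (p ℕ.^_)
          (solve 2 (λ m k → let E = con 3 :+ con 4 :* m :+ k in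
             con 2 :+ (E :+ E :+ E) := con 4 :* (con 2 :+ con 3 :* m) :+ con 3 :* (con 1 :+ k)) ≡.refl m k) ⟩
        p ℕ.^ (4 ℕ.* (2 ℕ.+ 3 ℕ.* m) ℕ.+ 3 ℕ.* suc k) ∎)
      where
        E = 3 ℕ.+ 4 ℕ.* m ℕ.+ k
        σ = suc (2 ℕ.* m)
        P = p ℕ.^ E
        B = p ℕ.^ (suc σ ℕ.+ σ)
        σ≤ : suc σ ℕ.+ σ ℕ.≤ E
        σ≤ = ℕₚ.≤-trans (ℕₚ.m≤m+n _ k) (ℕₚ.≤-reflexive
          (solve 2 (λ m k → (con 2 :+ con 2 :* m) :+ (con 1 :+ con 2 :* m) :+ k
             := con 3 :+ con 4 :* m :+ k)
             ≡.refl m k))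
        N≤ : 3 ℕ.* (3 ℕ.* P ℕ.+ B) ℕ.≤ 12 ℕ.* P
        N≤ = ℕₚ.≤-trans (ℕₚ.*-monoʳ-≤ 3 (ℕₚ.+-monoʳ-≤ (3 ℕ.* P) (^-≤ σ≤)))
          (ℕₚ.≤-reflexive (solve 1 (λ y → con 3 :* (con 3 :* y :+ y) := con 12 :* y) ≡.refl P))

    transport : ∀ {a b k E σ} → a ≡ b → Balanced b k E σ → ∃₂ (Balanced a k)
    transport ≡.refl bal = _ , _ , bal

  balance : ∀ a k → 1 ℕ.≤ a → ∃₂ (Balanced a k)
  balance a k 1≤a with a ℕ.% 3 | a ℕ./ 3 | DivMod.m≡m%n+[m/n]*n a 3 | DivMod.m%n<n a 3
  -- At a = 0 the pattern of `balance₀` would give suc σ = 1 and E = k, and suc σ ≤ E would fail for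
  -- k = 0.
  ... | 0 | zero  | ≡.refl | _ = contradiction 1≤a λ ()
  ... | 0 | suc m | a≡ | _ = transport (≡.trans a≡ (ℕₚ.*-comm (suc m) 3)) (balance₀ m k)
  ... | 1 | m     | a≡ | _ = transport (≡.trans a≡ (≡.cong (1 ℕ.+_) (ℕₚ.*-comm m 3))) (balance₁ m k)
  ... | 2 | m     | a≡ | _ = transport (≡.trans a≡ (≡.cong (2 ℕ.+_) (ℕₚ.*-comm m 3))) (balance₂ m k)
  ... | suc (suc (suc _)) | _ | _ | s≤s (s≤s (s≤s ()))

-- The bound for q^t with q = p^(k+1).

open import Data.Nat using (_+_; _*_; _^_; _≤_)

theorem3p4 : ∀ {c ℓ c′ ℓ′} (q r : ℕ) → IsOddPrimePower q → 1 ≤ r →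
    let t = 2 * r + 1 in
    (F : FiniteField c ℓ q) (K : FiniteField c′ ℓ′ (q ^ t)) →
    let open Polynomial (FiniteField.commutativeRing F) in
    (∃ λ μ → Irreducible (X^ t - μ)) →
    ∀ (y : ℚ.ℚ) → y ≥∛ (q ^ (4 * r + 3)) →
    fromℕ (χ (G K)) ℚ.≤
    ((+ (2 * r + 5)) ℚ./ 3) ℚ.* y ℚ.+ fromℕ ((2 * r + 1) * q ^ (r + 1))
theorem3p4 q r (p , suc k , p-prime , p≢2 , _ , ≡.refl) 1≤r F K _ y y≥ =
  real-bound {a = 3 * P + B} {p ^ (4 * (suc k * r) + 3 * suc k)} {2 * r + 5}
    {(2 * r + 1) * (p ^ suc k) ^ (r + 1)} {y} χ≤ 1≤a 7≤T 1≤Z cubes y≥′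
  where
    open ℕSolver.+-*-Solver using (solve; _:+_; _:*_; _:=_; con)

    instance
      p≢0 : NonZero p
      p≢0 = prime⇒nonZero p-prime

    1<p : 1 ℕ.< p
    1<p = ℕ.nonTrivial⇒n>1 p {{prime⇒nonTrivial p-prime}}

    3≤p : 3 ≤ p
    3≤p = ℕₚ.≤∧≢⇒< 1<p (p≢2 ∘ ≡.sym)

    balanced = balance 3≤p (suc k * r) k (ℕₚ.*-mono-≤ (s≤s (z≤n {k})) 1≤r)
    E = proj₁ balanced
    σ = proj₁ (proj₂ balanced)
    P = p ^ E
    B = p ^ (suc σ + σ)
    exponent = proj₁ (proj₂ (proj₂ balanced))
    σ<E      = proj₁ (proj₂ (proj₂ (proj₂ balanced)))
    cubes    = proj₂ (proj₂ (proj₂ (proj₂ balanced)))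

    order≡ : (p ^ suc k) ^ (2 * r + 1) ≡ p ^ (E + suc σ)
    order≡ = ≡.trans (ℕₚ.^-*-assoc p (suc k) (2 * r + 1)) (≡.cong (p ^_) (≡.trans
      (solve 2 (λ k r → k :* (con 2 :* r :+ con 1) := con 2 :* (k :* r) :+ k) ≡.refl (suc k) r)
      exponent))

    y≥′ : y ≥∛ (p ^ (4 * (suc k * r) + 3 * suc k))
    y≥′ = ≡.subst (y ≥∛_) (≡.trans (ℕₚ.^-*-assoc p (suc k) (4 * r + 3)) (≡.cong (p ^_)
      (solve 2 (λ k r → k :* (con 4 :* r :+ con 3) := con 4 :* (k :* r) :+ con 3 :* k)
        ≡.refl (suc k) r))) y≥

    χ≤ : χ (G K) ≤ suc (3 * P + B)
    χ≤ = ℕₚ.≤-trans (χ-primePower K p-prime p≢2 E σ order≡ σ<E) (ℕₚ.≤-reflexive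
      (solve 2 (λ P B → con 2 :* P :+ (con 1 :+ (P :+ B)) := con 1 :+ (con 3 :* P :+ B))
        ≡.refl P B))

    1≤a : 1 ≤ 3 * P + B
    1≤a = ℕₚ.≤-trans (ℕₚ.m^n>0 p (suc σ + σ)) (ℕₚ.m≤n+m B (3 * P))

    7≤T : 7 ≤ 2 * r + 5
    7≤T = ℕₚ.+-monoˡ-≤ 5 (ℕₚ.*-monoʳ-≤ 2 1≤r)

    1≤Z : 1 ≤ (2 * r + 1) * (p ^ suc k) ^ (r + 1)
    1≤Z = ℕₚ.*-mono-≤ (ℕₚ.m≤n+m 1 (2 * r)) (ℕₚ.m^n>0 (p ^ suc k) {{ℕₚ.m^n≢0 p (suc k)}} (r + 1))
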